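{- (1) Let $\mathcal P$ be a chiral or directly regular polytope. Then $\mathcal P \diamond \mathcal P^{\delta}$ is properly self-dual. (2) Let $\mathcal P$ be a chiral polytope and let $\mathcal Q = \mathcal P \diamond \overline{\mathcal P^{\delta}}$. Then $\mathcal Q = \overline{\mathcal Q^{\delta}}$; if $\mathcal Q$ is directly regular then it is (properly) self-dual, and if $\mathcal Q$ is chiral then it is improperly self-dual.
   Context: An abstract polytope of rank $n$ (an $n$-polytope) is a ranked poset of faces with ranks from $-1$ to $n$, with a unique least face (rank $-1$) and a unique greatest face (rank $n$), in which every flag (maximal chain) has $n+2$ faces, which satisfies the diamond condition (whenever $F<G$ with ranks $j-1$ and $j+1$ there are exactly two $j$-faces strictly between them), and which is strongly flag-connected (any two flags $\Phi,\Psi$ are joined by a sequence of flags, consecutive ones adjacent, all containing $\Phi\cap\Psi$; two flags are adjacent if they differ in exactly one face). $\Phi^j$ denotes the unique flag differing from $\Phi$ only in its $j$-face, and $\Phi^{i,j}=(\Phi^i)^j$. Each polytope considered has a fixed base flag $\Phi$. $\mathcal P$ is regular if its automorphism group $\Gamma(\mathcal P)$ is transitive on flags; then $\Gamma(\mathcal P)$ is generated by $\rho_0,\dots,\rho_{n-1}$, where $\rho_i$ maps $\Phi$ to $\Phi^i$. Put $\sigma_i=\rho_{i-1}\rho_i$ and $\Gamma^+(\mathcal P)=\langle\sigma_1,\dots,\sigma_{n-1}\rangle$; $\mathcal P$ is directly regular if it is regular and $\Gamma^+(\mathcal P)$ has index $2$ in $\Gamma(\mathcal P)$. $\mathcal P$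 is chiral if $\Gamma(\mathcal P)$ has exactly two orbits on flags and adjacent flags lie in distinct orbits; then $\Gamma^+(\mathcal P):=\Gamma(\mathcal P)$ is generated by $\sigma_1,\dots,\sigma_{n-1}$, where $\sigma_i$ maps $\Phi$ to $\Phi^{i,i-1}$. In both cases $(\sigma_i\cdots\sigma_j)^2=1$ for $i<j$. Let $W^+=\langle \sigma_1,\dots,\sigma_{n-1}\mid (\sigma_i\cdots\sigma_j)^2=1 \text{ for } 1\le i<j\le n-1\rangle$. Writing $\Gamma^+(\mathcal P)=W^+/M$ means that $M$ is the kernel of the epimorphism $W^+\to\Gamma^+(\mathcal P)$ preserving the specified generators. For $w\in W^+$, $\overline w$ is obtained by replacing $\sigma_1$ by $\sigma_1^{ -1}$, $\sigma_2$ by $\sigma_1^2\sigma_2$ and fixing $\sigma_j$ for $j\ge3$; $\delta(w)$ is obtained by replacing each $\sigma_i$ by $\sigma_{n-i}^{ -1}$ (both are automorphisms of $W^+$). For $M\trianglelefteq W^+$ put $\overline M=\{\overline w: w\in M\}$, $\delta(M)=\{\delta(w):w\in M\}$; one has $\delta(\overline M)=\overline{\delta(M)}$. If $\Gamma^+(\mathcal P)=W^+/M$, then the dual $\mathcal P^\delta$ (reversed partial order) has $\Gamma^+(\mathcal P^\delta)=W^+/\delta(M)$; $\mathcal P$ is directly regular if $\overline M=M$ and chiral otherwise; and the mirror image $\overline{\mathcal P}$ of a chiral $\mathcal P$ (same faces, base flag $\Phi^0$) has $\Gamma^+(\overline{\mathcal P})=W^+/\overline M$. Mix: $\mathcal P\diamond\mathcal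 Q$ denotes the flag-connected pre-polytope (polytope axioms with strong flag-connectedness weakened to flag-connectedness) built from the group $\Gamma^+(\mathcal P)\diamond\Gamma^+(\mathcal Q)$, the subgroup of $\Gamma^+(\mathcal P)\times\Gamma^+(\mathcal Q)$ with specified generators $\beta_i=(\sigma_i,\sigma_i')$. It is handled through its rotation group $\Gamma^+(\mathcal P\diamond\mathcal Q)=\Gamma^+(\mathcal P)\diamond\Gamma^+(\mathcal Q)=W^+/N$: it is directly regular if $\overline N=N$ and chiral otherwise; equality of two such structures means equality of the corresponding normal subgroups of $W^+$, and dual and mirror image correspond to $\delta(N)$ and $\overline N$. Such a structure is properly self-dual if $\delta(N)=N$ (equivalently there is a duality, i.e. order-reversing bijection, fixing the base flag); a chiral one is improperly self-dual if $\delta(N)=\overline N$ (it is self-dual, but no duality fixes the base flag). -}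

module Defs where

open import Level using (Level; _⊔_; 0ℓ) renaming (suc to lsuc)
open import Algebra.Bundles using (Group; RawGroup)
open import Algebra.Core using (Op₂)
import Algebra.Construct.DirectProduct as Product
import Algebra.Morphism.GroupMonomorphism as GroupMonomorphism
import Relation.Binary.Construct.Flip.EqAndOrd as Flip
open import Data.Fin.Base as Fin using (Fin; zero; suc; toℕ; fromℕ; inject₁; opposite)
open import Data.Fin.Induction using (<-weakInduction; >-weakInduction)
import Data.Fin.Properties as Fin
open import Data.Fin.Relation.Unary.Top using (view; ‵fromℕ; ‵inject₁)
open import Data.Nat.Base as ℕ using (ℕ; zero; suc; _+_; z≤n; s≤s)
import Data.Nat.Properties as ℕ
open import Data.Product.Base using (Σ; ∃; ∃-syntax; _×_; _,_; proj₁; proj₂)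
open import Data.Sum.Base using (_⊎_; inj₁; inj₂; [_,_]′)
open import Function.Base using (_∘_; id; flip)
open import Function.Bundles using (_↔_; module Inverse)
open import Function.Properties.Inverse using (↔-refl; ↔-sym; ↔-trans)
open import Relation.Binary.Core using (Rel)
open import Relation.Binary.Structures using (IsStrictPartialOrder)
open import Relation.Binary.PropositionalEquality using (_≡_; _≢_; refl; sym; trans; cong; cong₂; subst; subst₂)
open import Relation.Nullary using (¬_; yes; no; contradiction)
open import Relation.Unary using (Pred; _≐_)

private
  variable
    a c ℓ ℓ₁ : Level
    k m n : ℕ

-- For an equivalence _~_: exactly two classes.
TwoClasses : {A : Set a} → Rel A ℓ → Set (a ⊔ ℓ)
TwoClasses {A = A} _~_ =
  ∃[ x ] ∃[ y ] ¬ (x ~ y) × (∀ (z : A) → (z ~ x) ⊎ (z ~ y))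

-- In rank n = m + 1 the generators σ₁ , … , σₘ of W⁺ are indexed by
-- Fin m, so gen i stands for σ_{toℕ i + 1}.

infixl 7 _∙_
infix  8 _⁻¹

data Word (m : ℕ) : Set where
  gen : Fin m → Word m
  ε   : Word m
  _∙_ : Word m → Word m → Word m
  _⁻¹ : Word m → Word m

-- segment _·_ e f i j = f i · f (i + 1) · ⋯ · f j for i ≤ j.
segment : {A : Set a} → Op₂ A → A → (Fin m → A) → Fin m → Fin m → A
segment _·_ e f zero zero = f zero
segment {m = suc (suc m)} _·_ e f zero (suc j) = f zero · segment _·_ e (f ∘ suc) zero j
segment _·_ e f (suc i) zero = e
segment _·_ e f (suc i) (suc j) = segment _·_ e (f ∘ suc) i j

infix 4 _≃_

data _≃_ {m : ℕ} : Rel (Word m) 0ℓ where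
  reflexive : ∀ {u} → u ≃ u
  symmetric : ∀ {u v} → u ≃ v → v ≃ u
  transitive : ∀ {u v w} → u ≃ v → v ≃ w → u ≃ w
  ∙-cong : ∀ {u u′ v v′} → u ≃ u′ → v ≃ v′ → u ∙ v ≃ u′ ∙ v′
  ⁻¹-cong : ∀ {u v} → u ≃ v → u ⁻¹ ≃ v ⁻¹
  assoc : ∀ u v w → (u ∙ v) ∙ w ≃ u ∙ (v ∙ w)
  identityˡ : ∀ u → ε ∙ u ≃ u
  identityʳ : ∀ u → u ∙ ε ≃ u
  inverseˡ : ∀ u → u ⁻¹ ∙ u ≃ ε
  inverseʳ : ∀ u → u ∙ u ⁻¹ ≃ ε
  relator : ∀ {i j} → i Fin.< j →
    segment _∙_ ε gen i j ∙ segment _∙_ ε gen i j ≃ ε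

W⁺ : ℕ → Group 0ℓ 0ℓ
W⁺ m = record
  { Carrier = Word m
  ; _≈_ = _≃_
  ; _∙_ = _∙_
  ; ε = ε
  ; _⁻¹ = _⁻¹
  ; isGroup = record
    { isMonoid = record
      { isSemigroup = record
        { isMagma = record
          { isEquivalence = record
            { refl = reflexive ; sym = symmetric ; trans = transitive }
          ; ∙-cong = ∙-cong
          }
        ; assoc = assoc
        }
      ; identity = identityˡ , identityʳ
      }
    ; inverse = inverseˡ , inverseʳ
    ; ⁻¹-cong = ⁻¹-cong
    }
  }

eval : (G : Group c ℓ) → (Fin m → Group.Carrier G) → Word m → Group.Carrier G
eval G f (gen i) = f i
eval G f ε = Group.ε G
eval G f (u ∙ v) = Group._∙_ G (eval G f u) (eval G f v)
eval G f (u ⁻¹) = Group._⁻¹ G (eval G f u)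

overline-gen : Fin m → Word m
overline-gen zero = gen zero ⁻¹
overline-gen (suc zero) = gen zero ∙ gen zero ∙ gen (suc zero)
overline-gen (suc (suc j)) = gen (suc (suc j))

overline : Word m → Word m
overline {m} = eval (W⁺ m) overline-gen

-- The index shift turns n - i into opposite i.
δ : Word m → Word m
δ {m} = eval (W⁺ m) (λ i → gen (opposite i) ⁻¹)

image : (Word m → Word m) → Pred (Word m) ℓ → Pred (Word m) ℓ
image φ N v = ∃[ w ] N w × v ≃ φ w

Relators : (G : Group c ℓ) → (Fin m → Group.Carrier G) → Set ℓ
Relators {m = m} G f = ∀ {i j : Fin m} → i Fin.< j →
  (segment _·_ e f i j · segment _·_ e f i j) ≈ e
  where open Group G using (_≈_) renaming (_∙_ to _·_; ε to e)

Generated : (G : Group c ℓ) → (Fin m → Group.Carrier G) → Pred (Group.Carrier G) ℓ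
Generated G f g = ∃[ w ] Group._≈_ G (eval G f w) g

record RotationGroup (c ℓ : Level) (m : ℕ) : Set (lsuc (c ⊔ ℓ)) where
  field
    group     : Group c ℓ
    σ         : Fin m → Group.Carrier group
    relators  : Relators group σ
    generates : ∀ g → Generated group σ g

-- The normal subgroup N of W⁺ with R = W⁺/N.
ker : RotationGroup c ℓ m → Pred (Word m) ℓ
ker R w = Group._≈_ group (eval group σ w) (Group.ε group)
  where open RotationGroup R

eval-segment : (G : Group c ℓ) (h : Fin m → Group.Carrier G) (f : Fin k → Word m) (i j : Fin k) →
  eval G h (segment _∙_ ε f i j) ≡ segment (Group._∙_ G) (Group.ε G) (eval G h ∘ f) i j
eval-segment G h f zero zero = refl
eval-segment {k = suc (suc k)} G h f zero (suc j) =
  cong (Group._∙_ G _) (eval-segment G h (f ∘ suc) zero j)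
eval-segment G h f (suc i) zero = refl
eval-segment G h f (suc i) (suc j) = eval-segment G h (f ∘ suc) i j

-- The epimorphism W⁺ → Γ⁺ is well defined.
eval-cong : (R : RotationGroup c ℓ m) → let open RotationGroup R in
  ∀ {u v} → u ≃ v → Group._≈_ group (eval group σ u) (eval group σ v)
eval-cong {m = m} R = go
  where
  open RotationGroup R
  module G = Group group
  go : ∀ {u v : Word m} → u ≃ v → eval group σ u G.≈ eval group σ v
  go reflexive = G.refl
  go (symmetric p) = G.sym (go p)
  go (transitive p q) = G.trans (go p) (go q)
  go (∙-cong p q) = G.∙-cong (go p) (go q)
  go (⁻¹-cong p) = G.⁻¹-cong (go p)
  go (assoc u v w) = G.assoc _ _ _
  go (identityˡ u) = G.identityˡ _
  go (identityʳ u) = G.identityʳ _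
  go (inverseˡ u) = G.inverseˡ _
  go (inverseʳ u) = G.inverseʳ _
  go (relator {i} {j} i<j) =
    subst (λ s → (s G.∙ s) G.≈ G.ε) (sym (eval-segment group σ gen i j)) (relators i<j)

module _ (G : Group c ℓ) (f : Fin m → Group.Carrier G) where
  private module G = Group G

  subgroup : Group (c ⊔ ℓ) ℓ
  subgroup = record
    { RawGroup raw
    ; isGroup = GroupMonomorphism.isGroup {G₁ = raw} {G₂ = G.rawGroup} {⟦_⟧ = proj₁}
        record
          { isGroupHomomorphism = record
            { isMonoidHomomorphism = record
              { isMagmaHomomorphism = record
                { isRelHomomorphism = record { cong = id }
                ; homo = λ _ _ → G.refl
                }
              ; ε-homo = G.refl
              }
            ; ⁻¹-homo = λ _ → G.refl
            }
          ; injective = id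
          }
        G.isGroup
    }
    where
    raw : RawGroup (c ⊔ ℓ) ℓ
    raw = record
      { Carrier = Σ G.Carrier (Generated G f)
      ; _≈_ = λ x y → proj₁ x G.≈ proj₁ y
      ; _∙_ = λ (x , u , p) (y , v , q) → x G.∙ y , u ∙ v , G.∙-cong p q
      ; ε = G.ε , ε , G.refl
      ; _⁻¹ = λ (x , u , p) → x G.⁻¹ , u ⁻¹ , G.⁻¹-cong p
      }

  subgroup-gen : Fin m → Group.Carrier subgroup
  subgroup-gen i = f i , gen i , G.refl

  eval-subgroup : ∀ w → proj₁ (eval subgroup subgroup-gen w) ≡ eval G f w
  eval-subgroup (gen i) = refl
  eval-subgroup ε = refl
  eval-subgroup (u ∙ v) = cong₂ G._∙_ (eval-subgroup u) (eval-subgroup v)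
  eval-subgroup (u ⁻¹) = cong G._⁻¹ (eval-subgroup u)

  generatedBy : Relators G f → RotationGroup (c ⊔ ℓ) ℓ m
  generatedBy rel = record
    { group = subgroup
    ; σ = subgroup-gen
    ; relators = λ {i} {j} i<j →
        subst (λ s → (s G.∙ s) G.≈ G.ε) (sym (segment-subgroup i j)) (rel i<j)
    ; generates = λ (g , w , p) → w , G.trans (G.reflexive (eval-subgroup w)) p
    }
    where
    segment-subgroup : ∀ i j →
      proj₁ (segment (Group._∙_ subgroup) (Group.ε subgroup) subgroup-gen i j) ≡ segment G._∙_ G.ε f i j
    segment-subgroup i j =
      trans (cong proj₁ (sym (eval-segment subgroup subgroup-gen gen i j)))
        (trans (eval-subgroup (segment _∙_ ε gen i j)) (eval-segment G f gen i j))

infixl 7 _⋄_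

_⋄_ : RotationGroup c ℓ m → RotationGroup c ℓ m → RotationGroup (c ⊔ ℓ) ℓ m
_⋄_ {m = m} R S = generatedBy R×S β relators
  where
  module R = RotationGroup R
  module S = RotationGroup S
  module RG = Group R.group
  module SG = Group S.group
  R×S = Product.group R.group S.group
  β : Fin m → Group.Carrier R×S
  β i = R.σ i , S.σ i
  segment-× : ∀ {k} (f : Fin k → RG.Carrier) (g : Fin k → SG.Carrier) i j →
    segment (Group._∙_ R×S) (Group.ε R×S) (λ x → f x , g x) i j ≡
    (segment RG._∙_ RG.ε f i j , segment SG._∙_ SG.ε g i j)
  segment-× f g zero zero = refl
  segment-× {suc (suc k)} f g zero (suc j) = cong (Group._∙_ R×S _) (segment-× (f ∘ suc) (g ∘ suc) zero j)
  segment-× f g (suc i) zero = refl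
  segment-× f g (suc i) (suc j) = segment-× (f ∘ suc) (g ∘ suc) i j
  relators : Relators R×S β
  relators {i} {j} i<j =
    subst (λ s → Group._≈_ R×S (Group._∙_ R×S s s) (Group.ε R×S)) (sym (segment-× R.σ S.σ i j))
      (R.relators i<j , S.relators i<j)

-- The mix P ⋄ Q need not be a polytope; it is represented by its rotation
-- group W⁺/N, and its properties are those of N = ker R.
DirectlyRegularMix ChiralMix ProperlySelfDual ImproperlySelfDual : RotationGroup c ℓ m → Set ℓ
DirectlyRegularMix R = image overline (ker R) ≐ ker R
ChiralMix R = ¬ DirectlyRegularMix R
ProperlySelfDual R = image δ (ker R) ≐ ker R
ImproperlySelfDual R = ChiralMix R × image δ (ker R) ≐ image overline (ker R)

-- The order is given by its strict part.  Rank r is encoded as r + 1 in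
-- Fin (2 + n), so that the ranks run from -1 to n.
record RankedPoset (a ℓ : Level) (n : ℕ) : Set (lsuc (a ⊔ ℓ)) where
  infix 4 _<_
  field
    Face                 : Set a
    _<_                  : Rel Face ℓ
    isStrictPartialOrder : IsStrictPartialOrder _≡_ _<_
    rank                 : Face → Fin (2 + n)
    rank-mono            : ∀ {F G} → F < G → rank F Fin.< rank G
    least                : Face
    least-rank           : rank least ≡ zero
    least-least          : ∀ F → (least ≡ F) ⊎ (least < F)
    greatest             : Face
    greatest-rank        : rank greatest ≡ fromℕ (1 + n)
    greatest-greatest    : ∀ F → (F ≡ greatest) ⊎ (F < greatest)

  <-trans : ∀ {F G H} → F < G → G < H → F < H
  <-trans = IsStrictPartialOrder.trans isStrictPartialOrder

  <-irrefl : ∀ {F} → ¬ F < F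
  <-irrefl = IsStrictPartialOrder.irrefl isStrictPartialOrder refl

  Comparable : Rel Face (a ⊔ ℓ)
  Comparable F G = F < G ⊎ F ≡ G ⊎ G < F

  Between : Face → Face → Face → Set ℓ
  Between F H G = F < H × H < G × toℕ (rank H) ≡ 1 + toℕ (rank F)

-- Finite chains are all chains, since ranks are bounded and strictly
-- increasing.
record Chain (R : RankedPoset a ℓ n) (k : ℕ) : Set (a ⊔ ℓ) where
  open RankedPoset R
  field
    face       : Fin k → Face
    increasing : ∀ {i j} → i Fin.< j → face i < face j

open Chain public

infix 4 _∈_

_∈_ : {R : RankedPoset a ℓ n} → RankedPoset.Face R → Chain R k → Set a
F ∈ C = ∃[ i ] face C i ≡ F

Maximal : {R : RankedPoset a ℓ n} → Chain R k → Set (a ⊔ ℓ)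
Maximal {R = R} C = ∀ F → (∀ i → Comparable F (face C i)) → F ∈ C
  where open RankedPoset R

-- Flags are the maximal chains.  In a polytope these are exactly the
-- chains of n + 2 faces: see flag-length and flag-maximal.  The face of
-- rank r of a flag is the one with index r + 1: see rank-face.
Flag : RankedPoset a ℓ n → Set (a ⊔ ℓ)
Flag {n = n} R = Chain R (2 + n)

module _ {R : RankedPoset a ℓ n} where
  infix 4 _≈_

  _≈_ : Rel (Flag R) a
  Φ ≈ Ψ = ∀ i → face Φ i ≡ face Ψ i

  AdjacentAt : Fin (2 + n) → Rel (Flag R) a
  AdjacentAt j Φ Ψ = face Ψ j ≢ face Φ j × (∀ i → i ≢ j → face Ψ i ≡ face Φ i)

  Adjacent : Rel (Flag R) a
  Adjacent Φ Ψ = ∃[ j ] AdjacentAt j Φ Ψ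

  -- Sequences of successively adjacent flags, all of which but possibly
  -- the first satisfy K.
  data Path (K : Pred (Flag R) a) : Rel (Flag R) (a ⊔ ℓ) where
    done : ∀ {Φ Ψ} → Φ ≈ Ψ → Path K Φ Ψ
    step : ∀ {Φ Θ Ψ} → Adjacent Φ Θ → K Θ → Path K Θ Ψ → Path K Φ Ψ

  ContainsMeet : Flag R → Flag R → Pred (Flag R) a
  ContainsMeet Φ Ψ Θ = ∀ F → F ∈ Φ → F ∈ Ψ → F ∈ Θ

record Polytope (a ℓ : Level) (n : ℕ) : Set (lsuc (a ⊔ ℓ)) where
  field
    rankedPoset : RankedPoset a ℓ n
  open RankedPoset rankedPoset public
  field
    flag-length : ∀ {k} (C : Chain rankedPoset k) → Maximal C → k ≡ 2 + n
    -- Classically automatic, as chains have at most n + 2 faces.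
    extend      : ∀ {k} (C : Chain rankedPoset k) →
                  ∃[ l ] ∃[ D ] Maximal {k = l} {R = rankedPoset} D × (∀ F → F ∈ C → F ∈ D)
    diamond     : ∀ {F G} → F < G → toℕ (rank G) ≡ 2 + toℕ (rank F) →
                  ∃[ H₁ ] ∃[ H₂ ] H₁ ≢ H₂ × Between F H₁ G × Between F H₂ G ×
                    (∀ H → Between F H G → (H ≡ H₁) ⊎ (H ≡ H₂))
    connected   : (Φ Ψ : Flag rankedPoset) → Path (ContainsMeet Φ Ψ) Φ Ψ

FlagOf : Polytope a ℓ n → Set (a ⊔ ℓ)
FlagOf P = Flag (Polytope.rankedPoset P)

opaque
  increasing⇒id : (f : Fin k → Fin k) → (∀ {i j} → i Fin.< j → f i Fin.< f j) → ∀ i → f i ≡ i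
  increasing⇒id {suc k} f mono i = Fin.toℕ-injective (ℕ.≤-antisym (upper i) (lower i))
    where
    inject₁<suc : (j : Fin k) → inject₁ j Fin.< suc j
    inject₁<suc j = s≤s (ℕ.≤-reflexive (Fin.toℕ-inject₁ j))
    lower : ∀ i → toℕ i ℕ.≤ toℕ (f i)
    lower = <-weakInduction _ z≤n λ j le →
      ℕ.≤-<-trans (subst (ℕ._≤ toℕ (f (inject₁ j))) (Fin.toℕ-inject₁ j) le) (mono (inject₁<suc j))
    upper : ∀ i → toℕ (f i) ℕ.≤ toℕ i
    upper = >-weakInduction _
      (ℕ.≤-trans (Fin.toℕ≤pred[n] (f (fromℕ k))) (ℕ.≤-reflexive (sym (Fin.toℕ-fromℕ k))))
      λ j le → subst (toℕ (f (inject₁ j)) ℕ.≤_) (sym (Fin.toℕ-inject₁ j))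
        (ℕ.s≤s⁻¹ (ℕ.≤-trans (mono (inject₁<suc j)) le))

cases : (j : Fin k) (Q : Pred (Fin k) a) → Q j → (∀ i → i ≢ j → Q i) → ∀ i → Q i
cases j Q at off i with i Fin.≟ j
... | yes refl = at
... | no i≢j = off i i≢j

-- The index in a flag of its face of rank toℕ j; 0 ≤ toℕ j < n.
proper : Fin n → Fin (2 + n)
proper j = suc (inject₁ j)

proper-injective : {i j : Fin n} → proper i ≡ proper j → i ≡ j
proper-injective = Fin.inject₁-injective ∘ Fin.suc-injective

module Flags (P : Polytope a ℓ n) where
  open Polytope P

  rank-face : (Φ : FlagOf P) → ∀ i → rank (face Φ i) ≡ i
  rank-face Φ = increasing⇒id (rank ∘ face Φ) (rank-mono ∘ increasing Φ)

  same-rank : ∀ {F G} → Comparable F G → rank F ≡ rank G → F ≡ G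
  same-rank (inj₁ F<G) eq = contradiction (rank-mono F<G) (ℕ.<-irrefl (cong toℕ eq))
  same-rank (inj₂ (inj₁ F≡G)) eq = F≡G
  same-rank (inj₂ (inj₂ G<F)) eq = contradiction (rank-mono G<F) (ℕ.<-irrefl (cong toℕ (sym eq)))

  flag-maximal : (Φ : FlagOf P) → Maximal Φ
  flag-maximal Φ F comparable =
    rank F , sym (same-rank (comparable (rank F)) (sym (rank-face Φ (rank F))))

  in-flag : ∀ F → Σ (FlagOf P) (F ∈_)
  in-flag F with extend (record { face = λ (_ : Fin 1) → F ; increasing = λ { {zero} {zero} () } })
  ... | l , D , max , sub with flag-length D max
  ... | refl = D , sub F (zero , refl)

  below above : Fin n → Fin (2 + n)
  below j = inject₁ (inject₁ j)
  above j = suc (suc j)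

  toℕ-below : ∀ j → toℕ (below j) ≡ toℕ j
  toℕ-below j = trans (Fin.toℕ-inject₁ _) (Fin.toℕ-inject₁ j)

  toℕ-proper : (j : Fin n) → toℕ (proper j) ≡ 1 + toℕ j
  toℕ-proper j = cong suc (Fin.toℕ-inject₁ j)

  below<proper : ∀ j → below j Fin.< proper j
  below<proper j = ℕ.≤-reflexive (trans (cong suc (toℕ-below j)) (sym (toℕ-proper j)))

  proper<above : ∀ j → proper j Fin.< above j
  proper<above j = ℕ.≤-reflexive (cong suc (toℕ-proper j))

  between-proper : (Φ : FlagOf P) (j : Fin n) {F : Face} →
    face Φ (below j) < F → F < face Φ (above j) → toℕ (rank F) ≡ 1 + toℕ j →
    Between (face Φ (below j)) F (face Φ (above j))
  between-proper Φ j lt gt eq =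
    lt , gt , trans eq (cong suc (sym (trans (cong toℕ (rank-face Φ (below j))) (toℕ-below j))))

  face-between : (Φ : FlagOf P) (j : Fin n) →
    Between (face Φ (below j)) (face Φ (proper j)) (face Φ (above j))
  face-between Φ j = between-proper Φ j (increasing Φ (below<proper j)) (increasing Φ (proper<above j))
    (trans (cong toℕ (rank-face Φ (proper j))) (toℕ-proper j))

  opaque
    -- The second face in the section containing the j-face of Φ.
    other : (Φ : FlagOf P) (j : Fin n) → let F = face Φ (below j); G = face Φ (above j) in
      ∃[ X ] X ≢ face Φ (proper j) × Between F X G ×
        (∀ H → Between F H G → H ≢ face Φ (proper j) → H ≡ X)
    other Φ j
      with H₁ , H₂ , H₁≢H₂ , b₁ , b₂ , only ← diamond (increasing Φ (Fin.<-trans (below<proper j) (proper<above j)))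
             (trans (cong toℕ (rank-face Φ (above j)))
               (cong (2 +_) (sym (trans (cong toℕ (rank-face Φ (below j))) (toℕ-below j)))))
      with only _ (face-between Φ j)
    ... | inj₁ p = H₂ , (λ q → H₁≢H₂ (sym (trans q p))) , b₂ ,
            λ H b H≢ → [ (λ q → contradiction (trans q (sym p)) H≢) , id ]′ (only H b)
    ... | inj₂ p = H₁ , (λ q → H₁≢H₂ (trans q p)) , b₁ ,
            λ H b H≢ → [ id , (λ q → contradiction (trans q (sym p)) H≢) ]′ (only H b)

  replace : (Fin (2 + n) → Face) → Fin (2 + n) → Face → Fin (2 + n) → Face
  replace f j X i with i Fin.≟ j
  ... | yes _ = X
  ... | no _ = f i

  replace-at : ∀ f j X → replace f j X j ≡ X
  replace-at f j X with j Fin.≟ j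
  ... | yes _ = refl
  ... | no ¬p = contradiction refl ¬p

  replace-off : ∀ f j X i → i ≢ j → replace f j X i ≡ f i
  replace-off f j X i i≢j with i Fin.≟ j
  ... | yes p = contradiction p i≢j
  ... | no _ = refl

  ≤-face : (Φ : FlagOf P) → ∀ {i j} → toℕ i ℕ.≤ toℕ j → (face Φ i ≡ face Φ j) ⊎ (face Φ i < face Φ j)
  ≤-face Φ {i} {j} i≤j with ℕ.m≤n⇒m<n∨m≡n i≤j
  ... | inj₁ i<j = inj₂ (increasing Φ i<j)
  ... | inj₂ i≡j = inj₁ (cong (face Φ) (Fin.toℕ-injective i≡j))

  infixl 9 _^_

  below≢ : ∀ j → below j ≢ proper j
  below≢ j p = ℕ.<-irrefl (cong toℕ p) (below<proper j)

  above≢ : ∀ j → above j ≢ proper j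
  above≢ j p = ℕ.<-irrefl (cong toℕ (sym p)) (proper<above j)

  opaque
    -- Φ ^ j is the flag Φʲ; see ^-unique.
    _^_ : FlagOf P → Fin n → FlagOf P
    face (Φ ^ j) = replace (face Φ) (proper j) (proj₁ (other Φ j))
    increasing (Φ ^ j) {x} {y} x<y with x Fin.≟ proper j | y Fin.≟ proper j
    ... | yes refl | yes refl = contradiction x<y (ℕ.<-irrefl refl)
    ... | no _ | no _ = increasing Φ x<y
    ... | yes refl | no _
      with _ , X<above , _ ← proj₁ (proj₂ (proj₂ (other Φ j)))
      with ≤-face Φ {above j} {y} (subst (ℕ._< toℕ y) (toℕ-proper j) x<y)
    ...   | inj₁ eq = subst (proj₁ (other Φ j) <_) eq X<above
    ...   | inj₂ lt = <-trans X<above lt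
    increasing (Φ ^ j) {x} {y} x<y | no _ | yes refl
      with below<X , _ ← proj₁ (proj₂ (proj₂ (other Φ j)))
      with ≤-face Φ {x} {below j} (subst (toℕ x ℕ.≤_) (sym (toℕ-below j)) (ℕ.s≤s⁻¹ (subst (toℕ x ℕ.<_) (toℕ-proper j) x<y)))
    ...   | inj₁ eq = subst (_< proj₁ (other Φ j)) (sym eq) below<X
    ...   | inj₂ lt = <-trans lt below<X

    ^-off : ∀ Φ j i → i ≢ proper j → face (Φ ^ j) i ≡ face Φ i
    ^-off Φ j = replace-off (face Φ) (proper j) _

    ^-adjacent : ∀ Φ j → AdjacentAt (proper j) Φ (Φ ^ j)
    ^-adjacent Φ j =
      (λ p → proj₁ (proj₂ (other Φ j)) (trans (sym (replace-at (face Φ) (proper j) _)) p)) , ^-off Φ j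

    ^-local : (Φ Ψ : FlagOf P) (j : Fin n) → face Ψ (below j) ≡ face Φ (below j) → face Ψ (above j) ≡ face Φ (above j) →
      face Ψ (proper j) ≢ face Φ (proper j) → face Ψ (proper j) ≡ face (Φ ^ j) (proper j)
    ^-local Φ Ψ j eqᵇ eqᵃ ≢ = trans
      (proj₂ (proj₂ (proj₂ (other Φ j))) _
        (subst₂ (λ F G → Between F (face Ψ (proper j)) G) eqᵇ eqᵃ (face-between Ψ j)) ≢)
      (sym (replace-at (face Φ) (proper j) _))

  ^-unique : (Φ Ψ : FlagOf P) (j : Fin n) → AdjacentAt (proper j) Φ Ψ → Ψ ≈ Φ ^ j
  ^-unique Φ Ψ j (at , off) = cases (proper j) (λ i → face Ψ i ≡ face (Φ ^ j) i)
    (^-local Φ Ψ j (off _ (below≢ j)) (off _ (above≢ j)) at)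
    (λ i i≢ → trans (off i i≢) (sym (^-off Φ j i i≢)))

  ≈-refl : {Φ : FlagOf P} → Φ ≈ Φ
  ≈-refl i = refl

  ≈-sym : {Φ Ψ : FlagOf P} → Φ ≈ Ψ → Ψ ≈ Φ
  ≈-sym p i = sym (p i)

  ≈-trans : {Φ Ψ Θ : FlagOf P} → Φ ≈ Ψ → Ψ ≈ Θ → Φ ≈ Θ
  ≈-trans p q i = trans (p i) (q i)

  ^-cong : {Φ Ψ : FlagOf P} (j : Fin n) → Φ ≈ Ψ → Φ ^ j ≈ Ψ ^ j
  ^-cong {Φ} {Ψ} j p = ^-unique Ψ (Φ ^ j) j
    ( (λ q → proj₁ (^-adjacent Φ j) (trans q (sym (p (proper j)))))
    , λ i i≢ → trans (^-off Φ j i i≢) (p i) )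

  ^-involutive : ∀ Φ j → (Φ ^ j) ^ j ≈ Φ
  ^-involutive Φ j = ≈-sym {Φ} {(Φ ^ j) ^ j} (^-unique (Φ ^ j) Φ j
    ((λ q → proj₁ (^-adjacent Φ j) (sym q)) , λ i i≢ → sym (^-off Φ j i i≢)))

  ^-comm : ∀ Φ i j → 1 + toℕ i ℕ.< toℕ j → (Φ ^ i) ^ j ≈ (Φ ^ j) ^ i
  ^-comm Φ i j i+1<j = ≈-sym {(Φ ^ j) ^ i} {(Φ ^ i) ^ j} (^-unique (Φ ^ i) ((Φ ^ j) ^ i) j
    ( (λ q → proj₁ (^-adjacent Φ j)
        (trans (sym (^-off (Φ ^ j) i _ (i≢j ∘ sym))) (trans q (^-off Φ i _ (i≢j ∘ sym)))))
    , off ))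
    where
    i≢j : proper i ≢ proper j
    i≢j p = ℕ.<-irrefl (cong toℕ (proper-injective p)) (ℕ.<-trans (ℕ.n<1+n _) i+1<j)
    belowi≢j : below i ≢ proper j
    belowi≢j p = ℕ.<-irrefl (trans (sym (toℕ-below i)) (trans (cong toℕ p) (toℕ-proper j)))
      (ℕ.<-trans (ℕ.n<1+n _) (ℕ.<-trans i+1<j (ℕ.n<1+n _)))
    abovei≢j : above i ≢ proper j
    abovei≢j p = ℕ.<-irrefl (ℕ.suc-injective (trans (cong toℕ p) (toℕ-proper j))) i+1<j
    off : ∀ x → x ≢ proper j → face ((Φ ^ j) ^ i) x ≡ face (Φ ^ i) x
    off x x≢j = cases (proper i) (λ x → x ≢ proper j → face ((Φ ^ j) ^ i) x ≡ face (Φ ^ i) x)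
      (λ _ → ^-local Φ ((Φ ^ j) ^ i) i
        (trans (^-off (Φ ^ j) i _ (below≢ i)) (^-off Φ j _ belowi≢j))
        (trans (^-off (Φ ^ j) i _ (above≢ i)) (^-off Φ j _ abovei≢j))
        (λ q → proj₁ (^-adjacent (Φ ^ j) i) (trans q (sym (^-off Φ j _ i≢j)))))
      (λ x x≢i x≢j → trans (^-off (Φ ^ j) i x x≢i) (trans (^-off Φ j x x≢j) (sym (^-off Φ i x x≢i))))
      x x≢j

  adjacent⇒^ : (Φ Ψ : FlagOf P) → Adjacent Φ Ψ → ∃[ j ] Ψ ≈ Φ ^ j
  adjacent⇒^ Φ Ψ (zero , at , _) = contradiction (trans (bottom Ψ) (sym (bottom Φ))) at
    where
    bottom : (Θ : FlagOf P) → face Θ zero ≡ least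
    bottom Θ = sym (same-rank ([ inj₂ ∘ inj₁ , inj₁ ]′ (least-least (face Θ zero)))
      (trans least-rank (sym (rank-face Θ zero))))
  adjacent⇒^ Φ Ψ (suc i , at , off) with view i
  ... | ‵inject₁ j = j , ^-unique Φ Ψ j (at , off)
  ... | ‵fromℕ = contradiction (trans (top Ψ) (sym (top Φ))) at
    where
    top : (Θ : FlagOf P) → face Θ (suc (fromℕ n)) ≡ greatest
    top Θ = same-rank ([ inj₂ ∘ inj₁ , inj₁ ]′ (greatest-greatest (face Θ (suc (fromℕ n)))))
      (trans (rank-face Θ (suc (fromℕ n))) (sym greatest-rank))
record Automorphism (P : Polytope a ℓ n) : Set (a ⊔ ℓ) where
  open Polytope P
  field
    bijection : Face ↔ Face
  open Inverse bijection public using (to; from; strictlyInverseˡ; strictlyInverseʳ)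
  field
    to-mono   : ∀ {F G} → F < G → to F < to G
    from-mono : ∀ {F G} → F < G → from F < from G

  to-injective : ∀ {F G} → to F ≡ to G → F ≡ G
  to-injective p = trans (sym (strictlyInverseʳ _)) (trans (cong from p) (strictlyInverseʳ _))

-- Automorphisms act on the right: α ∙ β is α followed by β.
Γ : Polytope a ℓ n → Group (a ⊔ ℓ) a
Γ P = record
  { Carrier = Automorphism P
  ; _≈_ = λ α β → ∀ F → to α F ≡ to β F
  ; _∙_ = λ α β → record
    { bijection = ↔-trans (bijection α) (bijection β)
    ; to-mono = to-mono β ∘ to-mono α
    ; from-mono = from-mono α ∘ from-mono β
    }
  ; ε = record { bijection = ↔-refl ; to-mono = id ; from-mono = id }
  ; _⁻¹ = λ α → record { bijection = ↔-sym (bijection α) ; to-mono = from-mono α ; from-mono = to-mono α }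
  ; isGroup = record
    { isMonoid = record
      { isSemigroup = record
        { isMagma = record
          { isEquivalence = record
            { refl = λ F → refl ; sym = λ p F → sym (p F) ; trans = λ p q F → trans (p F) (q F) }
          ; ∙-cong = λ {_} {_} {β} p q F → trans (cong (to β) (p F)) (q _)
          }
        ; assoc = λ _ _ _ F → refl
        }
      ; identity = (λ _ F → refl) , (λ _ F → refl)
      }
    ; inverse = (λ α F → strictlyInverseˡ α F) , (λ α F → strictlyInverseʳ α F)
    ; ⁻¹-cong = λ {α} {β} p F → to-injective α
        (trans (strictlyInverseˡ α F) (sym (trans (p _) (strictlyInverseˡ β F))))
    }
  }
  where open Automorphism

act : {P : Polytope a ℓ n} → Automorphism P → FlagOf P → FlagOf P
face (act α Φ) i = Automorphism.to α (face Φ i)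
increasing (act α Φ) i<j = Automorphism.to-mono α (increasing Φ i<j)

Orbit : (P : Polytope a ℓ n) → Rel (FlagOf P) (a ⊔ ℓ)
Orbit P Φ Ψ = ∃[ α ] act {P = P} α Φ ≈ Ψ

Chiral Regular : Polytope a ℓ n → Set (a ⊔ ℓ)
Chiral P = TwoClasses (Orbit P) × (∀ Φ Ψ → Adjacent Φ Ψ → ¬ Orbit P Φ Ψ)
Regular P = ∀ Φ Ψ → Orbit P Φ Ψ

-- g and h lie in the same right coset of H iff g h⁻¹ ∈ H.
IndexTwo : (G : Group c ℓ) → Pred (Group.Carrier G) ℓ₁ → Set (c ⊔ ℓ₁)
IndexTwo G H = TwoClasses λ g h → H (g · h ⁱ)
  where open Group G using () renaming (_∙_ to _·_; _⁻¹ to _ⁱ)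

module Action (P : Polytope a ℓ n) where
  open Polytope P
  open Flags P
  open Automorphism
  open Group (Γ P) using () renaming (_∙_ to _·_; ε to 1#; _⁻¹ to _ⁱ; _≈_ to _≗_)

  act-cong : (α : Automorphism P) {Φ Ψ : FlagOf P} → Φ ≈ Ψ → act α Φ ≈ act α Ψ
  act-cong α p i = cong (to α) (p i)

  act-^ : (α : Automorphism P) (Φ : FlagOf P) (j : Fin n) → act α (Φ ^ j) ≈ act α Φ ^ j
  act-^ α Φ j = ^-unique (act α Φ) (act α (Φ ^ j)) j
    ( (λ q → proj₁ (^-adjacent Φ j) (to-injective α q))
    , λ i i≢ → cong (to α) (^-off Φ j i i≢) )

  orbit-sym : (Φ Ψ : FlagOf P) → Orbit P Φ Ψ → Orbit P Ψ Φ
  orbit-sym _ _ (α , p) = α ⁱ , λ i → trans (cong (from α) (sym (p i))) (strictlyInverseʳ α _)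

  orbit-trans : (Φ Ψ Θ : FlagOf P) → Orbit P Φ Ψ → Orbit P Ψ Θ → Orbit P Φ Θ
  orbit-trans _ _ _ (α , p) (β , q) = α · β , λ i → trans (cong (to β) (p i)) (q i)

  fixes-flags : (α : Automorphism P) {K : Pred (FlagOf P) a} {Φ Ψ : FlagOf P} →
    Path K Φ Ψ → act α Φ ≈ Φ → act α Ψ ≈ Ψ
  fixes-flags α (done p) fix i = trans (cong (to α) (sym (p i))) (trans (fix i) (p i))
  fixes-flags α {Φ = Φ} (step {Θ = Θ} adj _ path) fix with j , p ← adjacent⇒^ Φ Θ adj =
    fixes-flags α path λ i → trans (act-cong α {Θ} {Φ ^ j} p i)
      (trans (act-^ α Φ j i) (trans (^-cong j fix i) (sym (p i))))

  -- Automorphisms are determined by the image of any one flag.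
  free : (α β : Automorphism P) (Φ : FlagOf P) → act α Φ ≈ act β Φ → α ≗ β
  free α β Φ p F with Ψ , i , refl ← in-flag F =
    trans (sym (strictlyInverseˡ β _)) (cong (to β)
      (fixes-flags (α · β ⁱ) (connected Φ Ψ)
        (λ x → trans (cong (from β) (p x)) (strictlyInverseʳ β _)) i))

record PointedPolytope (a ℓ : Level) (n : ℕ) : Set (lsuc (a ⊔ ℓ)) where
  field
    polytope : Polytope a ℓ n
    base     : FlagOf polytope

-- As for W⁺, σ i stands for σ_{toℕ i + 1}, whereas ρ j stands for ρ_{toℕ j}.
module _ (P : PointedPolytope a ℓ (suc m)) where
  open PointedPolytope P
  open Flags polytope
  open Action polytope
  open Automorphism using (to; from; strictlyInverseˡ; strictlyInverseʳ)
  open Group (Γ polytope) using () renaming (_∙_ to _·_; ε to 1#; _⁻¹ to _ⁱ; _≈_ to _≗_)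

  IsRotations : (Fin m → Automorphism polytope) → Set a
  IsRotations σ = ∀ i → act (σ i) base ≈ (base ^ suc i) ^ inject₁ i

  regular-ρ : Regular polytope → Fin (suc m) → Automorphism polytope
  regular-ρ reg j = proj₁ (reg base (base ^ j))

  regular-σ : Regular polytope → Fin m → Automorphism polytope
  regular-σ reg i = regular-ρ reg (inject₁ i) · regular-ρ reg (suc i)

  DirectlyRegular : Set (a ⊔ ℓ)
  DirectlyRegular = Σ (Regular polytope) λ reg →
    IndexTwo (Γ polytope) (Generated (Γ polytope) (regular-σ reg))

  chiral-rotation : Chiral polytope → ∀ i → Orbit polytope base ((base ^ suc i) ^ inject₁ i)
  chiral-rotation ((X , Y , _ , class) , adj) i =
    go (class base) (class (base ^ suc i)) (class ((base ^ suc i) ^ inject₁ i))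
    where
    Φ₁ = base ^ suc i
    Φ₂ = Φ₁ ^ inject₁ i
    adj′ : ∀ Φ j Z → Orbit polytope Φ Z → ¬ Orbit polytope (Φ ^ j) Z
    adj′ Φ j Z p q = adj Φ (Φ ^ j) (proper j , ^-adjacent Φ j)
      (orbit-trans Φ Z (Φ ^ j) p (orbit-sym (Φ ^ j) Z q))
    go : _ → _ → _ → Orbit polytope base Φ₂
    go (inj₁ p) (inj₁ q) _ = contradiction q (adj′ base _ X p)
    go (inj₂ p) (inj₂ q) _ = contradiction q (adj′ base _ Y p)
    go _ (inj₁ q) (inj₁ r) = contradiction r (adj′ Φ₁ _ X q)
    go _ (inj₂ q) (inj₂ r) = contradiction r (adj′ Φ₁ _ Y q)
    go (inj₁ p) (inj₂ q) (inj₁ r) = orbit-trans base X Φ₂ p (orbit-sym Φ₂ X r)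
    go (inj₂ p) (inj₁ q) (inj₂ r) = orbit-trans base Y Φ₂ p (orbit-sym Φ₂ Y r)

  chiral-σ : Chiral polytope → Fin m → Automorphism polytope
  chiral-σ ch i = proj₁ (chiral-rotation ch i)

  chiral-isRotations : (ch : Chiral polytope) → IsRotations (chiral-σ ch)
  chiral-isRotations ch i = proj₂ (chiral-rotation ch i)

  regular-isRotations : (reg : Regular polytope) → IsRotations (regular-σ reg)
  regular-isRotations reg i x =
    trans (act-cong ρ₂ {act ρ₁ base} {base ^ inject₁ i} (proj₂ (reg base (base ^ inject₁ i))) x)
      (trans (act-^ ρ₂ base (inject₁ i) x)
        (^-cong (inject₁ i) (proj₂ (reg base (base ^ suc i))) x))
    where
    ρ₁ = regular-ρ reg (inject₁ i)
    ρ₂ = regular-ρ reg (suc i)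

  act-^^ : (α : Automorphism polytope) (Φ : FlagOf polytope) (i j : Fin (suc m)) →
    act α ((Φ ^ i) ^ j) ≈ (act α Φ ^ i) ^ j
  act-^^ α Φ i j x = trans (act-^ α (Φ ^ i) j x) (^-cong j (act-^ α Φ i) x)

  ^^-cong : {Φ Ψ : FlagOf polytope} (i j : Fin (suc m)) → Φ ≈ Ψ → (Φ ^ i) ^ j ≈ (Ψ ^ i) ^ j
  ^^-cong i j p = ^-cong j (^-cong i p)

  segment-act : ∀ {k} (f : Fin k → Automorphism polytope) (r : Fin (suc k) → Fin (suc m)) →
    (∀ x → act (f x) base ≈ (base ^ r (suc x)) ^ r (inject₁ x)) →
    ∀ i j → i Fin.≤ j → act (segment _·_ 1# f i j) base ≈ (base ^ r (suc j)) ^ r (inject₁ i)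
  segment-act f r rot zero zero _ = rot zero
  segment-act {suc (suc k)} f r rot zero (suc j) _ x =
    trans (act-cong S {act (f zero) base} {(base ^ r (suc zero)) ^ r zero} (rot zero) x)
      (trans (act-^^ S base (r (suc zero)) (r zero) x)
        (trans (^^-cong (r (suc zero)) (r zero) (segment-act (f ∘ suc) (r ∘ suc) (rot ∘ suc) zero j z≤n) x)
          (^-cong (r zero) (^-involutive (base ^ r (suc (suc j))) (r (suc zero))) x)))
    where S = segment _·_ 1# (f ∘ suc) zero j
  segment-act f r rot (suc i) (suc j) (s≤s le) = segment-act (f ∘ suc) (r ∘ suc) (rot ∘ suc) i j le

  rotations-relators : {σ : Fin m → Automorphism polytope} → IsRotations σ → Relators (Γ polytope) σ
  rotations-relators {σ} rot {i} {j} i<j = free (S · S) 1# base λ x →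
    trans (act-cong S {act S base} {(base ^ q) ^ p} act-S x)
      (trans (act-^^ S base q p x)
        (trans (^^-cong q p act-S x)
          (trans (^-cong p (^-comm (base ^ q) p q p+1<q) x)
            (trans (^-involutive ((base ^ q) ^ q) p x) (^-involutive base q x)))))
    where
    S = segment _·_ 1# σ i j
    p = inject₁ i
    q = suc j
    p+1<q : 1 + toℕ p ℕ.< toℕ q
    p+1<q = s≤s (subst (ℕ._< toℕ j) (sym (Fin.toℕ-inject₁ i)) i<j)
    act-S = segment-act σ id rot i j (ℕ.<⇒≤ i<j)

  -- Every flag is the image of base or base ^ 0 under a product of rotations.
  module _ {σ : Fin m → Automorphism polytope} (rot : IsRotations σ) where
    private
      ⟦_⟧ : Word m → Automorphism polytope
      ⟦_⟧ = eval (Γ polytope) σ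

    from-zero : ∀ j → ∃[ w ] act ⟦ w ⟧ (base ^ zero) ≈ base ^ j
    from-zero = <-weakInduction _ (ε , λ _ → refl) λ i (w , p) → w ∙ gen i , λ x →
      trans (act-cong (σ i) {act ⟦ w ⟧ (base ^ zero)} {base ^ inject₁ i} p x)
        (trans (act-^ (σ i) base (inject₁ i) x)
          (trans (^-cong (inject₁ i) (rot i) x) (^-involutive (base ^ suc i) (inject₁ i) x)))

    from-base : ∀ j → ∃[ w ] act ⟦ w ⟧ base ≈ (base ^ zero) ^ j
    from-base j = let w , p = from-zero j in w ⁻¹ , λ x → trans
      (cong (from ⟦ w ⟧) (sym (trans (act-^ ⟦ w ⟧ (base ^ zero) j x)
        (trans (^-cong j p x) (^-involutive base j x)))))
      (strictlyInverseʳ ⟦ w ⟧ _)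

    Reached : FlagOf polytope → Set a
    Reached Ψ = ∃ λ w → (act ⟦ w ⟧ base ≈ Ψ) ⊎ (act ⟦ w ⟧ (base ^ zero) ≈ Ψ)

    reach : {K : Pred (FlagOf polytope) a} {Φ Ψ : FlagOf polytope} → Path K Φ Ψ → Reached Φ → Reached Ψ
    reach (done q) (w , inj₁ p) = w , inj₁ λ x → trans (p x) (q x)
    reach (done q) (w , inj₂ p) = w , inj₂ λ x → trans (p x) (q x)
    reach {Φ = Φ} (step {Θ = Θ} adj _ path) reached = reach path (next reached)
      where
      j = proj₁ (adjacent⇒^ Φ Θ adj)
      q = proj₂ (adjacent⇒^ Φ Θ adj)
      next : Reached Φ → Reached Θ
      next (w , inj₁ p) = let u , r = from-zero j in u ∙ w , inj₂ λ x →
        trans (act-cong ⟦ w ⟧ {act ⟦ u ⟧ (base ^ zero)} {base ^ j} r x)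
          (trans (act-^ ⟦ w ⟧ base j x) (trans (^-cong j p x) (sym (q x))))
      next (w , inj₂ p) = let u , r = from-base j in u ∙ w , inj₁ λ x →
        trans (act-cong ⟦ w ⟧ {act ⟦ u ⟧ base} {(base ^ zero) ^ j} r x)
          (trans (act-^ ⟦ w ⟧ (base ^ zero) j x) (trans (^-cong j p x) (sym (q x))))

    chiral-generates : Chiral polytope → ∀ α → Generated (Γ polytope) σ α
    chiral-generates (_ , adj) α
      with reach (Polytope.connected polytope base (act α base)) (ε , inj₁ λ _ → refl)
    ... | w , inj₁ p = w , free ⟦ w ⟧ α base p
    ... | w , inj₂ p = contradiction
      (orbit-trans base (act α base) (base ^ zero) (α , λ _ → refl)
        (orbit-sym (base ^ zero) (act α base) (⟦ w ⟧ , p)))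
      (adj base (base ^ zero) (proper zero , ^-adjacent base zero))

  ChiralOrDirectlyRegular : Set (a ⊔ ℓ)
  ChiralOrDirectlyRegular = Chiral polytope ⊎ DirectlyRegular

  -- In the chiral case this is the whole group, by chiral-generates.
  Γ⁺ : ChiralOrDirectlyRegular → RotationGroup (a ⊔ ℓ) a m
  Γ⁺ (inj₁ ch) = record
    { group = Γ polytope
    ; σ = chiral-σ ch
    ; relators = λ {i} {j} → rotations-relators (chiral-isRotations ch) {i} {j}
    ; generates = chiral-generates (chiral-isRotations ch) ch
    }
  Γ⁺ (inj₂ (reg , _)) = generatedBy (Γ polytope) (regular-σ reg)
    λ {i} {j} → rotations-relators (regular-isRotations reg) {i} {j}

mirror : PointedPolytope a ℓ (suc m) → PointedPolytope a ℓ (suc m)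
mirror P = record { polytope = polytope ; base = Flags._^_ polytope base zero }
  where open PointedPolytope P

toℕ-opposite : (i : Fin k) → toℕ (opposite i) + suc (toℕ i) ≡ k
toℕ-opposite i = trans (cong (_+ suc (toℕ i)) (Fin.opposite-prop i)) (ℕ.m∸n+n≡m (Fin.toℕ<n i))

opposite-shift : (d : ℕ) (i j : Fin k) → toℕ i ≡ d + toℕ j → toℕ (opposite j) ≡ d + toℕ (opposite i)
opposite-shift d i j p = ℕ.+-cancelʳ-≡ (suc (toℕ j)) _ _
  (trans (toℕ-opposite j) (trans (sym (toℕ-opposite i))
    (trans (cong (λ x → toℕ (opposite i) + suc x) p)
      (trans (cong (toℕ (opposite i) +_) (sym (ℕ.+-suc d (toℕ j))))
        (trans (sym (ℕ.+-assoc (toℕ (opposite i)) d _)) (cong (_+ suc (toℕ j)) (ℕ.+-comm _ d)))))))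

opposite-shift′ : (d : ℕ) (i j : Fin k) → toℕ (opposite i) ≡ d + toℕ (opposite j) → toℕ j ≡ d + toℕ i
opposite-shift′ d i j p = subst₂ (λ x y → toℕ x ≡ d + toℕ y)
  (Fin.opposite-involutive j) (Fin.opposite-involutive i) (opposite-shift d (opposite i) (opposite j) p)

opposite-< : {i j : Fin k} → i Fin.< j → opposite j Fin.< opposite i
opposite-< {i = i} {j} i<j = subst₂ ℕ._<_ (sym (Fin.opposite-prop j)) (sym (Fin.opposite-prop i))
  (ℕ.∸-monoʳ-< (s≤s i<j) (Fin.toℕ<n j))

opposite-proper : (j : Fin n) → opposite (proper j) ≡ proper (opposite j)
opposite-proper {n} j = Fin.toℕ-injective (ℕ.+-cancelʳ-≡ (suc (toℕ (proper j))) _ _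
  (trans (toℕ-opposite (proper j)) (sym
    (trans (cong₂ (λ x y → suc x + suc (suc y)) (Fin.toℕ-inject₁ (opposite j)) (Fin.toℕ-inject₁ j))
      (cong suc (trans (ℕ.+-suc _ _) (cong suc (toℕ-opposite j))))))))

opposite-inject₁ : (i : Fin m) → opposite (inject₁ i) ≡ suc (opposite i)
opposite-inject₁ i = trans (cong opposite (cong inject₁ (sym (Fin.opposite-involutive i))))
  (Fin.opposite-involutive (suc (opposite i)))

opposite-twice : {A : Set a} (f : Fin k → A) → ∀ i → f (opposite (opposite i)) ≡ f i
opposite-twice f i = cong f (Fin.opposite-involutive i)

dualPoset : RankedPoset a ℓ n → RankedPoset a ℓ n
dualPoset R = record
  { Face = Face
  ; _<_ = flip _<_
  ; isStrictPartialOrder = Flip.isStrictPartialOrder isStrictPartialOrder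
  ; rank = opposite ∘ rank
  ; rank-mono = opposite-< ∘ rank-mono
  ; least = greatest
  ; least-rank = trans (cong opposite greatest-rank) (Fin.opposite-involutive zero)
  ; least-least = [ inj₁ ∘ sym , inj₂ ]′ ∘ greatest-greatest
  ; greatest = least
  ; greatest-rank = cong opposite least-rank
  ; greatest-greatest = [ inj₁ ∘ sym , inj₂ ]′ ∘ least-least
  }
  where open RankedPoset R

module Reversal (R : RankedPoset a ℓ n) where
  private
    Rᵈ = dualPoset R
    Face = RankedPoset.Face R

  reverse : Chain R k → Chain Rᵈ k
  face (reverse C) = face C ∘ opposite
  increasing (reverse C) = increasing C ∘ opposite-<

  unreverse : Chain Rᵈ k → Chain R k
  face (unreverse C) = face C ∘ opposite
  increasing (unreverse C) = increasing C ∘ opposite-<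

  ∈-reverse : ∀ {F} (C : Chain R k) → F ∈ C → F ∈ reverse C
  ∈-reverse C (i , p) = opposite i , trans (opposite-twice (face C) i) p

  ∈-unreverse : ∀ {F} (C : Chain Rᵈ k) → F ∈ C → F ∈ unreverse C
  ∈-unreverse C (i , p) = opposite i , trans (opposite-twice (face C) i) p

  ∈-unreverse⁻ : ∀ {F} (C : Chain Rᵈ k) → F ∈ unreverse C → F ∈ C
  ∈-unreverse⁻ C (i , p) = opposite i , p

  ∈-reverse⁻ : ∀ {F} (C : Chain R k) → F ∈ reverse C → F ∈ C
  ∈-reverse⁻ C (i , p) = opposite i , p

  comparable-dual : ∀ {F G} → RankedPoset.Comparable Rᵈ F G → RankedPoset.Comparable R F G
  comparable-dual = [ inj₂ ∘ inj₂ , [ inj₂ ∘ inj₁ , inj₁ ]′ ]′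

  comparable-dual⁻ : ∀ {F G} → RankedPoset.Comparable R F G → RankedPoset.Comparable Rᵈ F G
  comparable-dual⁻ = [ inj₂ ∘ inj₂ , [ inj₂ ∘ inj₁ , inj₁ ]′ ]′

  maximal-reverse : (C : Chain R k) → Maximal C → Maximal (reverse C)
  maximal-reverse C max F comparable = ∈-reverse C (max F λ i →
    subst (RankedPoset.Comparable R F) (opposite-twice (face C) i) (comparable-dual (comparable (opposite i))))

  maximal-unreverse : (C : Chain Rᵈ k) → Maximal C → Maximal (unreverse C)
  maximal-unreverse C max F comparable = ∈-unreverse C (max F λ i →
    subst (RankedPoset.Comparable Rᵈ F) (opposite-twice (face C) i) (comparable-dual⁻ (comparable (opposite i))))

  adjacentAt-reverse : (Φ Ψ : Flag R) → ∀ {j} → AdjacentAt j Φ Ψ → AdjacentAt (opposite j) (reverse Φ) (reverse Ψ)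
  adjacentAt-reverse Φ Ψ {j} (at , off) =
    (λ p → at (trans (sym (opposite-twice (face Ψ) j)) (trans p (opposite-twice (face Φ) j)))) ,
    (λ i i≢ → off (opposite i) λ p → i≢ (trans (sym (Fin.opposite-involutive i)) (cong opposite p)))

  adjacent-unreverse : (Φ Ψ : Flag Rᵈ) → Adjacent Φ Ψ → Adjacent (unreverse Φ) (unreverse Ψ)
  adjacent-unreverse Φ Ψ (j , at , off) = opposite j ,
    (λ p → at (trans (sym (opposite-twice (face Ψ) j)) (trans p (opposite-twice (face Φ) j)))) ,
    (λ i i≢ → off (opposite i) λ p → i≢ (trans (sym (Fin.opposite-involutive i)) (cong opposite p)))

  path-reverse : {K : Pred (Flag R) a} {Kᵈ : Pred (Flag Rᵈ) a} → (∀ Θ → K Θ → Kᵈ (reverse Θ)) →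
    {Φ Ψ : Flag R} (Φᵈ Ψᵈ : Flag Rᵈ) → reverse Φ ≈ Φᵈ → reverse Ψ ≈ Ψᵈ → Path K Φ Ψ → Path Kᵈ Φᵈ Ψᵈ
  path-reverse conv Φᵈ Ψᵈ p q (done r) = done λ i → trans (sym (p i)) (trans (r (opposite i)) (q i))
  path-reverse conv {Φ} Φᵈ Ψᵈ p q (step {Θ = Θ} (j , adj) κ path)
    with at , off ← adjacentAt-reverse Φ Θ adj =
    step {Θ = reverse Θ} (opposite j , (λ r → at (trans r (sym (p _)))) , λ i i≢ → trans (off i i≢) (p i))
      (conv Θ κ) (path-reverse conv (reverse Θ) Ψᵈ (λ _ → refl) q path)

dualPolytope : Polytope a ℓ n → Polytope a ℓ n
dualPolytope P = record
  { rankedPoset = dualPoset rankedPoset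
  ; flag-length = λ C max → flag-length (unreverse C) (maximal-unreverse C max)
  ; extend = λ C → let l , D , max , sub = extend (unreverse C) in
      l , reverse D , maximal-reverse D max , λ F → ∈-reverse D ∘ sub F ∘ ∈-unreverse C
  ; diamond = dual-diamond
  ; connected = λ Φ Ψ → path-reverse
      (λ Θ meet F F∈Φ F∈Ψ → ∈-reverse Θ (meet F (∈-unreverse Φ F∈Φ) (∈-unreverse Ψ F∈Ψ)))
      Φ Ψ (opposite-twice (face Φ)) (opposite-twice (face Ψ)) (connected (unreverse Φ) (unreverse Ψ))
  }
  where
  open Polytope P
  open Reversal rankedPoset
  module D = RankedPoset (dualPoset rankedPoset)
  between : ∀ {F H G} → toℕ (rank F) ≡ 2 + toℕ (rank G) → Between G H F → D.Between F H G
  between {F} {H} eq (G<H , H<F , r) =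
    H<F , G<H , opposite-shift 1 (rank F) (rank H) (trans eq (cong suc (sym r)))
  between⁻ : ∀ {F H G} → toℕ (rank F) ≡ 2 + toℕ (rank G) → D.Between F H G → Between G H F
  between⁻ {F} {H} eq (H<F , G<H , r) =
    G<H , H<F , ℕ.suc-injective (trans (sym (opposite-shift′ 1 (rank H) (rank F) r)) eq)
  dual-diamond : ∀ {F G} → G < F → toℕ (opposite (rank G)) ≡ 2 + toℕ (opposite (rank F)) →
    ∃[ H₁ ] ∃[ H₂ ] H₁ ≢ H₂ × D.Between F H₁ G × D.Between F H₂ G ×
      (∀ H → D.Between F H G → (H ≡ H₁) ⊎ (H ≡ H₂))
  dual-diamond {F} {G} G<F eq =
    let eq′ = opposite-shift′ 2 (rank G) (rank F) eq
        H₁ , H₂ , H₁≢H₂ , b₁ , b₂ , only = diamond G<F eq′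
    in H₁ , H₂ , H₁≢H₂ , between eq′ b₁ , between eq′ b₂ , λ H → only H ∘ between⁻ eq′

infix 10 _ᵟ

_ᵟ : PointedPolytope a ℓ n → PointedPolytope a ℓ n
P ᵟ = record { polytope = dualPolytope polytope ; base = Reversal.reverse (Polytope.rankedPoset polytope) base }
  where open PointedPolytope P

module Dual (P : Polytope a ℓ n) where
  open Reversal (Polytope.rankedPoset P) public
  private
    Pᵈ = dualPolytope P
    module F = Flags P
    module Fᵈ = Flags Pᵈ
    module Γᵈ = Group (Γ Pᵈ)

  dual-automorphism : Automorphism P → Automorphism Pᵈ
  dual-automorphism α = record { bijection = bijection ; to-mono = to-mono ; from-mono = from-mono }
    where open Automorphism α

  undual-automorphism : Automorphism Pᵈ → Automorphism P
  undual-automorphism α = record { bijection = bijection ; to-mono = to-mono ; from-mono = from-mono }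
    where open Automorphism α

  reverse-^ : (Φ : FlagOf P) (j : Fin n) → reverse Φ Fᵈ.^ j ≈ reverse (Φ F.^ opposite j)
  reverse-^ Φ j = Fᵈ.≈-sym {reverse (Φ F.^ opposite j)} {reverse Φ Fᵈ.^ j}
    (Fᵈ.^-unique (reverse Φ) (reverse (Φ F.^ opposite j)) j
      (subst (λ x → AdjacentAt x (reverse Φ) (reverse (Φ F.^ opposite j)))
        (trans (opposite-proper (opposite j)) (cong proper (Fin.opposite-involutive j)))
        (adjacentAt-reverse Φ (Φ F.^ opposite j) (F.^-adjacent Φ (opposite j)))))

  orbit-dual : (Φ : FlagOf Pᵈ) (Ψ : FlagOf P) → Orbit P (unreverse Φ) Ψ → Orbit Pᵈ Φ (reverse Ψ)
  orbit-dual Φ Ψ (α , p) = dual-automorphism α , λ i →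
    trans (cong (λ x → Automorphism.to α (face Φ x)) (sym (Fin.opposite-involutive i))) (p (opposite i))

  orbit-undual : (Φ Ψ : FlagOf P) → Orbit Pᵈ (reverse Φ) (reverse Ψ) → Orbit P Φ Ψ
  orbit-undual Φ Ψ (α , p) = undual-automorphism α , λ i →
    trans (cong (λ x → Automorphism.to α (face Φ x)) (sym (Fin.opposite-involutive i)))
      (trans (p (opposite i)) (cong (face Ψ) (Fin.opposite-involutive i)))

  orbit-unreverse : (Φ Ψ : FlagOf Pᵈ) → Orbit Pᵈ Φ Ψ → Orbit P (unreverse Φ) (unreverse Ψ)
  orbit-unreverse Φ Ψ (α , p) = undual-automorphism α , p ∘ opposite

  dual-chiral : Chiral P → Chiral Pᵈ
  dual-chiral ((X , Y , X≁Y , class) , adj) =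
    (reverse X , reverse Y , X≁Y ∘ orbit-undual X Y , λ Z →
      [ inj₁ ∘ orbit-dual Z X , inj₂ ∘ orbit-dual Z Y ]′ (class (unreverse Z))) ,
    λ Φ Ψ a → adj (unreverse Φ) (unreverse Ψ) (adjacent-unreverse Φ Ψ a) ∘ orbit-unreverse Φ Ψ

  dual-regular : Regular P → Regular Pᵈ
  dual-regular reg Φ Ψ with α , p ← orbit-dual Φ (unreverse Ψ) (reg (unreverse Φ) (unreverse Ψ)) =
    α , λ i → trans (p i) (cong (face Ψ) (Fin.opposite-involutive i))

module DualRotations (P : PointedPolytope a ℓ (suc m)) where
  open PointedPolytope P
  open Dual polytope public
  private
    Pᵈ = dualPolytope polytope
    module F = Flags polytope
    module Fᵈ = Flags Pᵈ
    module A = Action polytope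
    module Aᵈ = Action Pᵈ
    module G = Group (Γ polytope)
    module Gᵈ = Group (Γ Pᵈ)
  open Automorphism using (to; from; strictlyInverseʳ)

  module _ {σ : Fin m → Automorphism polytope} {τ : Fin m → Automorphism Pᵈ}
           (rotσ : IsRotations P σ) (rotτ : IsRotations (P ᵟ) τ) where

    -- σᵢ of the dual is the inverse of σₙ₋ᵢ.
    dual-rotation : ∀ i → τ i Gᵈ.≈ dual-automorphism (σ (opposite i) G.⁻¹)
    dual-rotation i = Aᵈ.free (τ i) (dual-automorphism (σ j G.⁻¹)) (reverse base) λ x →
      trans (rotτ i x) (trans (Fᵈ.^-cong (inject₁ i) (λ y → Fᵈ-reverse (suc i) y) x)
        (trans (reverse-^ (base F.^ opposite (suc i)) (inject₁ i) x)
          (trans (cong (λ r → face ((base F.^ inject₁ j) F.^ r) (opposite x)) (opposite-inject₁ i))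
            (sym (inverse-act (opposite x))))))
      where
      j = opposite i
      Fᵈ-reverse = reverse-^ base
      inverse-act : act (σ j G.⁻¹) base ≈ (base F.^ inject₁ j) F.^ suc j
      inverse-act x = trans (cong (from (σ j)) (sym (image-act x))) (strictlyInverseʳ (σ j) _)
        where
        image-act : act (σ j) ((base F.^ inject₁ j) F.^ suc j) ≈ base
        image-act y = trans (act-^^ P (σ j) base (inject₁ j) (suc j) y)
          (trans (^^-cong P (inject₁ j) (suc j) (rotσ j) y)
            (trans (F.^-cong (suc j) (F.^-involutive (base F.^ suc j) (inject₁ j)) y)
              (F.^-involutive base (suc j) y)))

    rotation-undual : ∀ i → σ i G.≈ undual-automorphism (τ (opposite i) Gᵈ.⁻¹)
    rotation-undual i F = sym (trans
      (Gᵈ.⁻¹-cong {τ (opposite i)} {dual-automorphism (σ (opposite (opposite i)) G.⁻¹)} (dual-rotation (opposite i)) F)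
      (cong (λ j → to (σ j) F) (Fin.opposite-involutive i)))

    eval-dual : ∀ w → eval (Γ Pᵈ) τ w Gᵈ.≈ dual-automorphism (eval (Γ polytope) σ (δ w))
    eval-dual (gen i) = dual-rotation i
    eval-dual ε F = refl
    eval-dual (u ∙ v) = Gᵈ.∙-cong {eval (Γ Pᵈ) τ u} {dual-automorphism (eval (Γ polytope) σ (δ u))}
      {eval (Γ Pᵈ) τ v} {dual-automorphism (eval (Γ polytope) σ (δ v))} (eval-dual u) (eval-dual v)
    eval-dual (u ⁻¹) = Gᵈ.⁻¹-cong {eval (Γ Pᵈ) τ u} {dual-automorphism (eval (Γ polytope) σ (δ u))} (eval-dual u)

    eval-undual : ∀ w → eval (Γ polytope) σ w G.≈ undual-automorphism (eval (Γ Pᵈ) τ (δ w))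
    eval-undual (gen i) = rotation-undual i
    eval-undual ε F = refl
    eval-undual (u ∙ v) = G.∙-cong {eval (Γ polytope) σ u} {undual-automorphism (eval (Γ Pᵈ) τ (δ u))}
      {eval (Γ polytope) σ v} {undual-automorphism (eval (Γ Pᵈ) τ (δ v))} (eval-undual u) (eval-undual v)
    eval-undual (u ⁻¹) = G.⁻¹-cong {eval (Γ polytope) σ u} {undual-automorphism (eval (Γ Pᵈ) τ (δ u))} (eval-undual u)

  dual-directlyRegular : DirectlyRegular P → DirectlyRegular (P ᵟ)
  dual-directlyRegular (reg , α , β , distinct , class) =
    regᵈ , dual-automorphism α , dual-automorphism β ,
    (λ (w , p) → distinct (δ w , λ F → trans (sym (eval-dual rot rotᵈ w F)) (p F))) ,
    λ γ → [ inj₁ ∘ lift γ α , inj₂ ∘ lift γ β ]′ (class (undual-automorphism γ))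
    where
    regᵈ = dual-regular reg
    rot = regular-isRotations P reg
    rotᵈ = regular-isRotations (P ᵟ) regᵈ
    lift : ∀ γ α →
      Generated (Γ polytope) (regular-σ P reg) (undual-automorphism γ G.∙ α G.⁻¹) →
      Generated (Γ Pᵈ) (regular-σ (P ᵟ) regᵈ) (γ Gᵈ.∙ dual-automorphism α Gᵈ.⁻¹)
    lift γ α (w , p) = δ w , λ F → trans (sym (eval-undual rot rotᵈ w F)) (p F)

dual-chiralOrDirectlyRegular : (P : PointedPolytope a ℓ (suc m)) →
  ChiralOrDirectlyRegular P → ChiralOrDirectlyRegular (P ᵟ)
dual-chiralOrDirectlyRegular P =
  [ inj₁ ∘ DualRotations.dual-chiral P , inj₂ ∘ DualRotations.dual-directlyRegular P ]′

{-# OPTIONS --safe #-}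
-- For N = ker (P ⋄ Pᵟ), or N = ker Q, membership of w is a pair of conditions
-- on M = ker Γ⁺(P): w ∈ M and δ w ∈ M, respectively w ∈ M and δ (overline w) ∈ M.
-- As δ and overline are involutions of W⁺, everything follows once N is known
-- to be stable under δ, respectively under δ ∘ overline and overline ∘ δ.
-- The latter two maps differ by an inner automorphism of W⁺; this is seen on
-- flags, where it says that Φ⁰ and Φⁿ⁻¹ lie in one orbit, so that rotations
-- with respect to these two base flags have the same kernel.
module Submission where

open import Algebra.Bundles using (Group)
import Algebra.Construct.DirectProduct as Product
import Algebra.Properties.Group as GroupProperties
open import Data.Fin.Base using (Fin; zero; suc; fromℕ; inject₁; opposite; toℕ)
import Data.Fin.Properties as Fin
open import Data.Nat.Base using (ℕ; suc; s≤s; z≤n; _<_)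
import Data.Nat.Properties as ℕ
open import Data.Product.Base using (_×_; _,_; ∃-syntax; proj₁; proj₂)
open import Data.Sum.Base using (inj₁; inj₂)
open import Function.Base using (_∘_; id)
open import Level using (Level)
open import Relation.Binary.Bundles using (Setoid)
open import Relation.Binary.PropositionalEquality using (_≡_; refl; sym; trans; cong; cong₂; subst; subst₂)
import Relation.Binary.Reasoning.Setoid as SetoidReasoning
open import Relation.Unary using (Pred; _≐_)
open import Defs

private
  variable
    a c ℓ : Level
    k m n : ℕ

-- Group identities and evaluation of words

module _ (G : Group c ℓ) where
  private module G = Group G
  open G using (Carrier; setoid) renaming (_≈_ to infix 4 _≗_; _∙_ to infixl 7 _·_; ε to 1#; _⁻¹ to infix 8 _ⁱ)
  open GroupProperties G
  open SetoidReasoning setoid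

  -- As y and xy square to 1, xy = yx⁻¹, so x²y = xyx⁻¹ is a conjugate of y. Applied with x = σ₁ and
  -- y = σ₂⋯σⱼ.
  x²y-involutive : ∀ x y → y · y ≗ 1# → (x · y) · (x · y) ≗ 1# → (x · x · y) · (x · x · y) ≗ 1#
  x²y-involutive x y y² xy² = begin
    (x · x · y) · (x · x · y)        ≈⟨ G.∙-cong (G.assoc x x y) (G.assoc x x y) ⟩
    (x · (x · y)) · (x · (x · y))    ≈⟨ G.∙-congʳ (G.∙-congˡ xy≗yx⁻¹) ⟩
    (x · (y · x ⁱ)) · (x · (x · y))  ≈⟨ G.∙-congʳ (G.assoc x y (x ⁱ)) ⟨
    ((x · y) · x ⁱ) · (x · (x · y))  ≈⟨ G.assoc (x · y) (x ⁱ) _ ⟩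
    (x · y) · (x ⁱ · (x · (x · y)))  ≈⟨ G.∙-congˡ (\\-leftDividesʳ x (x · y)) ⟩
    (x · y) · (x · y)                ≈⟨ xy² ⟩
    1#                               ∎
    where
    xy≗yx⁻¹ : x · y ≗ y · x ⁱ
    xy≗yx⁻¹ = begin
      x · y      ≈⟨ inverseˡ-unique (x · y) (x · y) xy² ⟩
      (x · y) ⁱ  ≈⟨ ⁻¹-anti-homo-∙ x y ⟩
      y ⁱ · x ⁱ  ≈⟨ G.∙-congʳ (inverseˡ-unique y y y²) ⟨
      y · x ⁱ    ∎

  -- An intertwining relation passes from generators to products and inverses, so the values of a
  -- word under `f` and `h` are conjugate by `γ`; hence both evaluations have the same kernel.
  eval-intertwine : (f h : Fin m → Carrier) (γ : Carrier) → (∀ i → f i · γ ≗ γ · h i) →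
    ∀ w → eval G f w · γ ≗ γ · eval G h w
  eval-intertwine f h γ p (gen i) = p i
  eval-intertwine f h γ p ε = begin
    1# · γ  ≈⟨ G.identityˡ γ ⟩
    γ       ≈⟨ G.identityʳ γ ⟨
    γ · 1#  ∎
  eval-intertwine f h γ p (u ∙ v) = begin
    (eval G f u · eval G f v) · γ  ≈⟨ G.assoc _ _ _ ⟩
    eval G f u · (eval G f v · γ)  ≈⟨ G.∙-congˡ (eval-intertwine f h γ p v) ⟩
    eval G f u · (γ · eval G h v)  ≈⟨ G.assoc _ _ _ ⟨
    (eval G f u · γ) · eval G h v  ≈⟨ G.∙-congʳ (eval-intertwine f h γ p u) ⟩
    (γ · eval G h u) · eval G h v  ≈⟨ G.assoc _ _ _ ⟩
    γ · (eval G h u · eval G h v)  ∎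
  eval-intertwine f h γ p (u ⁻¹) = begin
    x ⁱ · γ                ≈⟨ G.∙-congˡ (//-rightDividesʳ y γ) ⟨
    x ⁱ · (γ · y · y ⁱ)    ≈⟨ G.∙-congˡ (G.∙-congʳ (eval-intertwine f h γ p u)) ⟨
    x ⁱ · (x · γ · y ⁱ)    ≈⟨ G.∙-congˡ (G.assoc x γ (y ⁱ)) ⟩
    x ⁱ · (x · (γ · y ⁱ))  ≈⟨ \\-leftDividesʳ x (γ · y ⁱ) ⟩
    γ · y ⁱ                ∎
    where
    x = eval G f u
    y = eval G h u

  intertwine-trivial : (x y γ : Carrier) → x · γ ≗ γ · y → x ≗ 1# → y ≗ 1#
  intertwine-trivial x y γ p x≗1 = identityʳ-unique γ y (begin
    γ · y   ≈⟨ p ⟨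
    x · γ   ≈⟨ G.∙-congʳ x≗1 ⟩
    1# · γ  ≈⟨ G.identityˡ γ ⟩
    γ       ∎)

  -- Trades `δ` or `overline` of a word for a change of generators, to which arguments on flags
  -- apply.
  eval-eval : (f : Fin m → Carrier) (g : Fin k → Word m) →
    ∀ w → eval G f (eval (W⁺ m) g w) ≡ eval G (eval G f ∘ g) w
  eval-eval f g (gen i) = refl
  eval-eval f g ε = refl
  eval-eval f g (u ∙ v) = cong₂ _·_ (eval-eval f g u) (eval-eval f g v)
  eval-eval f g (u ⁻¹) = cong _ⁱ (eval-eval f g u)

-- The involutions δ and overline of W⁺

eval-involutive : (g : Fin m → Word m) → (∀ i → eval (W⁺ m) g (g i) ≃ gen i) →
  ∀ w → eval (W⁺ m) g (eval (W⁺ m) g w) ≃ w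
eval-involutive g p (gen i) = p i
eval-involutive g p ε = reflexive
eval-involutive g p (u ∙ v) = ∙-cong (eval-involutive g p u) (eval-involutive g p v)
eval-involutive g p (u ⁻¹) = ⁻¹-cong (eval-involutive g p u)

δ-involutive : (w : Word m) → δ (δ w) ≃ w
δ-involutive {m} = eval-involutive _ λ i →
  subst (λ j → gen (opposite (opposite i)) ⁻¹ ⁻¹ ≃ gen j) (Fin.opposite-involutive i)
    (GroupProperties.⁻¹-involutive (W⁺ m) _)

overline-involutive : (w : Word m) → overline (overline w) ≃ w
overline-involutive {m} = eval-involutive overline-gen on-gen
  where
  open GroupProperties (W⁺ m)
  on-gen : ∀ i → overline (overline-gen i) ≃ gen i
  on-gen zero = ⁻¹-involutive _
  -- The word is σ₁⁻¹σ₁⁻¹(σ₁σ₁σ₂); the two pairs cancel from the inside.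
  on-gen (suc zero) = transitive (assoc _ _ _) (transitive
    (∙-cong reflexive (transitive (∙-cong reflexive (assoc _ _ _)) (\\-leftDividesʳ _ _)))
    (\\-leftDividesʳ _ _))
  on-gen (suc (suc j)) = reflexive

segment-overline-suc : (j : Fin (suc m)) →
  segment _∙_ ε (overline-gen ∘ suc) zero j ≃ gen zero ∙ gen zero ∙ segment _∙_ ε (gen ∘ suc) zero j
segment-overline-suc zero = reflexive
segment-overline-suc {suc m} (suc j) = assoc _ _ _

-- By the start of the segment: from σ₁ its value is unchanged, as σ₁⁻¹(σ₁²σ₂) = σ₁σ₂; from σ₂ it
-- gains the factor σ₁² and `x²y-involutive` applies; from σ₃ on it is untouched.
overline-relators : Relators (W⁺ m) overline-gen
overline-relators {suc (suc m)} {zero} {suc j} i<j =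
  transitive (∙-cong unchanged unchanged) (relator {i = zero} {suc j} i<j)
  where
  open GroupProperties (W⁺ (suc (suc m)))
  unchanged : segment _∙_ ε overline-gen zero (suc j) ≃ segment _∙_ ε gen zero (suc j)
  unchanged = transitive (∙-cong reflexive (transitive (segment-overline-suc j) (assoc _ _ _)))
    (\\-leftDividesʳ _ _)
overline-relators {suc (suc m)} {suc zero} {suc j} i<j =
  transitive (∙-cong (segment-overline-suc j) (segment-overline-suc j))
    (x²y-involutive (W⁺ _) _ _ (relator {i = suc zero} {suc j} i<j) (relator {i = zero} {suc j} (s≤s z≤n)))
overline-relators {suc (suc m)} {suc (suc i)} {suc zero} (s≤s ())
overline-relators {suc (suc m)} {suc (suc i)} {suc (suc j)} i<j = relator {i = suc (suc i)} {suc (suc j)} i<j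

-- The images of the generators satisfy the relators, so the subgroup they generate is a
-- `RotationGroup`, and evaluation in it is well defined.
overline-cong : {u v : Word m} → u ≃ v → overline u ≃ overline v
overline-cong {m} {u} {v} p = subst₂ _≃_
  (eval-subgroup (W⁺ m) overline-gen u) (eval-subgroup (W⁺ m) overline-gen v)
  (eval-cong (generatedBy (W⁺ m) overline-gen overline-relators) p)

-- Kernels

Respects≃ : Pred (Word m) ℓ → Set ℓ
Respects≃ N = ∀ {u v} → u ≃ v → N u → N v

ker-respects : (R : RotationGroup c ℓ m) → Respects≃ (ker R)
ker-respects R p q = G.trans (G.sym (eval-cong R p)) q
  where module G = Group (RotationGroup.group R)

ker-generatedBy : (G : Group c ℓ) (f : Fin m → Group.Carrier G) (rel : Relators G f) →
  ker (generatedBy G f rel) ≐ (λ w → Group._≈_ G (eval G f w) (Group.ε G))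
ker-generatedBy G f rel =
  (λ {w} → subst (λ x → Group._≈_ G x (Group.ε G)) (eval-subgroup G f w)) ,
  (λ {w} → subst (λ x → Group._≈_ G x (Group.ε G)) (sym (eval-subgroup G f w)))

module _ (R S : RotationGroup c ℓ m) where
  private
    module R = RotationGroup R
    module S = RotationGroup S
    R×S = Product.group R.group S.group
    β : Fin m → Group.Carrier R×S
    β i = R.σ i , S.σ i

  eval-× : ∀ w → eval R×S β w ≡ (eval R.group R.σ w , eval S.group S.σ w)
  eval-× (gen i) = refl
  eval-× ε = refl
  eval-× (u ∙ v) = cong₂ (Group._∙_ R×S) (eval-× u) (eval-× v)
  eval-× (u ⁻¹) = cong (Group._⁻¹ R×S) (eval-× u)

  ker-⋄ : ker (R ⋄ S) ≐ (λ w → ker R w × ker S w)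
  ker-⋄ =
    (λ {w} → subst (λ x → Group._≈_ R×S x (Group.ε R×S)) (trans (eval-subgroup R×S β w) (eval-× w))) ,
    (λ {w} → subst (λ x → Group._≈_ R×S x (Group.ε R×S)) (sym (trans (eval-subgroup R×S β w) (eval-× w))))

-- Rotations and change of base flag

-- Removes the case distinction: for directly regular `P` the group Γ⁺ is a proper subgroup, but its
-- kernel can be computed in the whole of Γ.
rotations : (P : PointedPolytope a ℓ (suc m)) (r : ChiralOrDirectlyRegular P) →
  ∃[ σ ] IsRotations P σ × ker (Γ⁺ P r) ≐ (λ w →
    Group._≈_ (Γ (PointedPolytope.polytope P)) (eval (Γ (PointedPolytope.polytope P)) σ w)
      (Group.ε (Γ (PointedPolytope.polytope P))))
rotations P (inj₁ ch) = chiral-σ P ch , chiral-isRotations P ch , id , id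
rotations P (inj₂ (reg , _)) = regular-σ P reg , regular-isRotations P reg ,
  ker-generatedBy (Γ (PointedPolytope.polytope P)) (regular-σ P reg)
    (λ {i} {j} → rotations-relators P (regular-isRotations P reg) {i} {j})

flagSetoid : Polytope a ℓ n → Setoid _ _
flagSetoid P = record
  { Carrier = FlagOf P
  ; _≈_ = _≈_
  ; isEquivalence = record
    { refl = λ {Φ} → ≈-refl {Φ} ; sym = λ {Φ} {Ψ} → ≈-sym {Φ} {Ψ} ; trans = λ {Φ} {Ψ} {Θ} → ≈-trans {Φ} {Ψ} {Θ} }
  }
  where open Flags P

module _ (P : PointedPolytope a ℓ (suc m)) where
  open PointedPolytope P
  open Flags polytope
  open Action polytope
  open SetoidReasoning (flagSetoid polytope)
  private
    𝔾 = Γ polytope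
    module G = Group 𝔾

  -- IsRotations P is RotationsAlong id base; with opposite in place of id one
  -- gets the rotations of the dual, without leaving P.
  RotationsAlong : (Fin (suc m) → Fin (suc m)) → FlagOf polytope → (Fin m → Automorphism polytope) → Set a
  RotationsAlong r Ψ σ = ∀ i → act (σ i) Ψ ≈ Ψ ^ r (suc i) ^ r (inject₁ i)

  -- Automorphisms commute with `_^_`, so both sides send Φ to the same flag, and an automorphism is
  -- determined by its effect on one flag.
  rotations-intertwine : ∀ r (Φ Ψ : FlagOf polytope) (σ τ : Fin m → Automorphism polytope) →
    RotationsAlong r Φ σ → RotationsAlong r Ψ τ → (γ : Automorphism polytope) → act γ Φ ≈ Ψ →
    ∀ i → (σ i G.∙ γ) G.≈ (γ G.∙ τ i)
  rotations-intertwine r Φ Ψ σ τ rotσ rotτ γ p i = free (σ i G.∙ γ) (γ G.∙ τ i) Φ (begin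
    act γ (act (σ i) Φ)                    ≈⟨ act-cong γ {act (σ i) Φ} {Φ ^ r (suc i) ^ r (inject₁ i)} (rotσ i) ⟩
    act γ (Φ ^ r (suc i) ^ r (inject₁ i))  ≈⟨ act-^^ P γ Φ (r (suc i)) (r (inject₁ i)) ⟩
    act γ Φ ^ r (suc i) ^ r (inject₁ i)    ≈⟨ ^^-cong P (r (suc i)) (r (inject₁ i)) p ⟩
    Ψ ^ r (suc i) ^ r (inject₁ i)          ≈⟨ rotτ i ⟨
    act (τ i) Ψ                            ≈⟨ act-cong (τ i) {act γ Φ} {Ψ} p ⟨
    act (τ i) (act γ Φ)                    ∎)

  -- The two systems of rotations are conjugate by `γ`, so the kernel depends only on the orbit of
  -- the flag.
  rotations-trivial : ∀ r (Φ Ψ : FlagOf polytope) (σ τ : Fin m → Automorphism polytope) →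
    RotationsAlong r Φ σ → RotationsAlong r Ψ τ → Orbit polytope Φ Ψ →
    ∀ w → eval 𝔾 σ w G.≈ G.ε → eval 𝔾 τ w G.≈ G.ε
  rotations-trivial r Φ Ψ σ τ rotσ rotτ (γ , p) w =
    intertwine-trivial 𝔾 (eval 𝔾 σ w) (eval 𝔾 τ w) γ
      (eval-intertwine 𝔾 σ τ γ (rotations-intertwine r Φ Ψ σ τ rotσ rotτ γ p) w)

  rotations-inverse : ∀ r Ψ σ → RotationsAlong r Ψ σ → ∀ i → act (σ i G.⁻¹) Ψ ≈ Ψ ^ r (inject₁ i) ^ r (suc i)
  rotations-inverse r Ψ σ rot i x = trans
    (cong (Automorphism.from (σ i)) (sym (σ-image x)))
    (Automorphism.strictlyInverseʳ (σ i) _)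
    where
    p = r (inject₁ i)
    q = r (suc i)
    σ-image : act (σ i) (Ψ ^ p ^ q) ≈ Ψ
    σ-image = begin
      act (σ i) (Ψ ^ p ^ q)  ≈⟨ act-^^ P (σ i) Ψ p q ⟩
      act (σ i) Ψ ^ p ^ q    ≈⟨ ^^-cong P p q (rot i) ⟩
      Ψ ^ q ^ p ^ p ^ q      ≈⟨ ^-cong q (^-involutive (Ψ ^ q) p) ⟩
      Ψ ^ q ^ q              ≈⟨ ^-involutive Ψ q ⟩
      Ψ                      ∎

  -- Inversion swaps the order of the two exchanges, and `opposite` swaps `suc` with `inject₁`; the
  -- two effects cancel.
  rotations-δ : ∀ r Ψ σ → RotationsAlong r Ψ σ → RotationsAlong (r ∘ opposite) Ψ (λ i → σ (opposite i) G.⁻¹)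
  rotations-δ r Ψ σ rot i = begin
    act (σ j G.⁻¹) Ψ                                  ≈⟨ rotations-inverse r Ψ σ rot j ⟩
    Ψ ^ r (inject₁ j) ^ r (suc j)                     ≡⟨ cong (λ k → Ψ ^ r (inject₁ j) ^ r k) (opposite-inject₁ i) ⟨
    Ψ ^ r (inject₁ j) ^ r (opposite (inject₁ i))      ∎
    where j = opposite i

  -- What `rotations-overline` asks of `r`. The rank `r zero` is the lowest one for `id` and the
  -- highest one for `opposite`.
  CommutesWithFirst : (Fin (suc m) → Fin (suc m)) → Set _
  CommutesWithFirst r = ∀ Ψ j → 1 < toℕ j → Ψ ^ r j ^ r zero ≈ Ψ ^ r zero ^ r j

  id-commutes : CommutesWithFirst id
  id-commutes Ψ j 1<j = ≈-sym {Ψ ^ zero ^ j} {Ψ ^ j ^ zero} (^-comm Ψ zero j 1<j)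

  opposite-commutes : CommutesWithFirst opposite
  -- `opposite zero` has value m and `opposite j` has value m - j, so the ranks differ by j > 1.
  opposite-commutes Ψ j 1<j = ^-comm Ψ (opposite j) (opposite zero) (ℕ.≤-trans
    (ℕ.≤-trans (ℕ.+-monoˡ-≤ (toℕ (opposite j)) 1<j) (ℕ.≤-reflexive (ℕ.+-comm (toℕ j) (toℕ (opposite j)))))
    (ℕ.≤-reflexive (trans
      (ℕ.suc-injective (trans (sym (ℕ.+-suc (toℕ (opposite j)) (toℕ j))) (toℕ-opposite j)))
      (sym (Fin.toℕ-fromℕ m)))))

  -- Each generator is traced back to its effect on Ψ, since automorphisms commute with `_^_`. From
  -- σ₃ on, the exchange at `r zero` commutes with both exchanges of the rotation.
  rotations-overline : ∀ r → CommutesWithFirst r → ∀ Ψ σ → RotationsAlong r Ψ σ →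
    RotationsAlong r (Ψ ^ r zero) (eval 𝔾 σ ∘ overline-gen)
  rotations-overline r comm Ψ σ rot zero = begin
    act (σ zero G.⁻¹) (Ψ ^ r zero)       ≈⟨ act-^ (σ zero G.⁻¹) Ψ (r zero) ⟩
    act (σ zero G.⁻¹) Ψ ^ r zero         ≈⟨ ^-cong (r zero) (rotations-inverse r Ψ σ rot zero) ⟩
    Ψ ^ r zero ^ r (suc zero) ^ r zero   ∎
  rotations-overline r comm Ψ σ rot (suc zero) = begin
    -- Applying `s` twice leads to `Ψ ^ r₁ ^ r₀ ^ r₁`, a form in which `τ` can be moved onto Ψ; then
    -- the inner exchanges at `r₁` cancel and those at `r₂` and `r₀` commute.
    act τ (act s (act s (Ψ ^ r₀)))
      ≈⟨ act-cong τ {act s (act s (Ψ ^ r₀))} {Ψ ^ r₁ ^ r₀ ^ r₁} (begin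
          act s (act s (Ψ ^ r₀))  ≈⟨ act-cong s {act s (Ψ ^ r₀)} {Ψ ^ r₁} once ⟩
          act s (Ψ ^ r₁)          ≈⟨ act-^ s Ψ r₁ ⟩
          act s Ψ ^ r₁            ≈⟨ ^-cong r₁ (rot zero) ⟩
          Ψ ^ r₁ ^ r₀ ^ r₁        ∎) ⟩
    act τ (Ψ ^ r₁ ^ r₀ ^ r₁)      ≈⟨ act-^^ P τ (Ψ ^ r₁) r₀ r₁ ⟩
    act τ (Ψ ^ r₁) ^ r₀ ^ r₁      ≈⟨ ^^-cong P r₀ r₁ (act-^ τ Ψ r₁) ⟩
    act τ Ψ ^ r₁ ^ r₀ ^ r₁        ≈⟨ ^^-cong P r₀ r₁ (^-cong r₁ (rot (suc zero))) ⟩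
    Ψ ^ r₂ ^ r₁ ^ r₁ ^ r₀ ^ r₁    ≈⟨ ^^-cong P r₀ r₁ (^-involutive (Ψ ^ r₂) r₁) ⟩
    Ψ ^ r₂ ^ r₀ ^ r₁              ≈⟨ ^-cong r₁ (comm Ψ (suc (suc zero)) (s≤s (s≤s z≤n))) ⟩
    Ψ ^ r₀ ^ r₂ ^ r₁              ∎
    where
    s = σ zero
    τ = σ (suc zero)
    r₀ = r zero
    r₁ = r (suc zero)
    r₂ = r (suc (suc zero))
    once : act s (Ψ ^ r₀) ≈ Ψ ^ r₁
    once = begin
      act s (Ψ ^ r₀)     ≈⟨ act-^ s Ψ r₀ ⟩
      act s Ψ ^ r₀       ≈⟨ ^-cong r₀ (rot zero) ⟩
      Ψ ^ r₁ ^ r₀ ^ r₀   ≈⟨ ^-involutive (Ψ ^ r₁) r₀ ⟩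
      Ψ ^ r₁             ∎
  rotations-overline r comm Ψ σ rot (suc (suc j)) = begin
    act (σ i) (Ψ ^ r zero)                ≈⟨ act-^ (σ i) Ψ (r zero) ⟩
    act (σ i) Ψ ^ r zero                  ≈⟨ ^-cong (r zero) (rot i) ⟩
    Ψ ^ r (suc i) ^ r (inject₁ i) ^ r zero
      ≈⟨ comm (Ψ ^ r (suc i)) (inject₁ i) (s≤s (s≤s z≤n)) ⟩
    Ψ ^ r (suc i) ^ r zero ^ r (inject₁ i)
      ≈⟨ ^-cong (r (inject₁ i)) (comm Ψ (suc i) (s≤s (s≤s z≤n))) ⟩
    Ψ ^ r zero ^ r (suc i) ^ r (inject₁ i) ∎
    where i = suc (suc j)

  -- Both composites give rotations along opposite, with respect to Φ⁰ and
  -- Φⁿ⁻¹ respectively, and these two flags lie in one orbit.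
  overline-δ-trivial : ∀ σ → IsRotations P σ →
    (λ w → eval 𝔾 σ (overline (δ w)) G.≈ G.ε) ≐ (λ w → eval 𝔾 σ (δ (overline w)) G.≈ G.ε)
  overline-δ-trivial σ rot =
    (λ {w} → subst (G._≈ G.ε) (sym (δ-overline w)) ∘
      rotations-trivial opposite Φ⁰ Φⁿ⁻¹ σ₁ σ₂ rot₁ rot₂ orbit w ∘ subst (G._≈ G.ε) (overline-δ w)) ,
    (λ {w} → subst (G._≈ G.ε) (sym (overline-δ w)) ∘
      rotations-trivial opposite Φⁿ⁻¹ Φ⁰ σ₂ σ₁ rot₂ rot₁ (orbit-sym Φ⁰ Φⁿ⁻¹ orbit) w ∘
      subst (G._≈ G.ε) (δ-overline w))
    where
    Φ⁰ = base ^ zero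
    Φⁿ⁻¹ = base ^ fromℕ m
    σ̄ = eval 𝔾 σ ∘ overline-gen
    σᵟ : Fin m → Automorphism polytope
    σᵟ i = σ (opposite i) G.⁻¹
    σ₁ σ₂ : Fin m → Automorphism polytope
    σ₁ i = σ̄ (opposite i) G.⁻¹
    σ₂ = eval 𝔾 σᵟ ∘ overline-gen
    rot₁ : RotationsAlong opposite Φ⁰ σ₁
    rot₁ = rotations-δ id Φ⁰ σ̄ (rotations-overline id id-commutes base σ rot)
    rot₂ : RotationsAlong opposite Φⁿ⁻¹ σ₂
    -- Along `opposite` the first rank is `opposite zero = fromℕ m`, which is why the new flag is
    -- Φⁿ⁻¹.
    rot₂ = rotations-overline opposite opposite-commutes base σᵟ (rotations-δ id base σ rot)
    overline-δ : ∀ w → eval 𝔾 σ (overline (δ w)) ≡ eval 𝔾 σ₁ w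
    overline-δ w = trans (eval-eval 𝔾 σ overline-gen (δ w)) (eval-eval 𝔾 σ̄ (λ i → gen (opposite i) ⁻¹) w)
    δ-overline : ∀ w → eval 𝔾 σ (δ (overline w)) ≡ eval 𝔾 σ₂ w
    δ-overline w = trans (eval-eval 𝔾 σ (λ i → gen (opposite i) ⁻¹) (overline w)) (eval-eval 𝔾 σᵟ overline-gen w)
    orbit : Orbit polytope Φ⁰ Φⁿ⁻¹
    -- Each σᵢ carries Φⁱ⁻¹ to Φⁱ, so the product of all generators carries Φ⁰ to Φⁿ⁻¹.
    orbit = let w , p = from-zero P rot (fromℕ m) in eval 𝔾 σ w , p

  -- From flags to kernels

  ker-overline-δ : (r : ChiralOrDirectlyRegular P) → ker (Γ⁺ P r) ∘ overline ∘ δ ≐ ker (Γ⁺ P r) ∘ δ ∘ overline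
  ker-overline-δ r with σ , rot , kerσ , kerσ⁻ ← rotations P r =
    (λ {w} → kerσ⁻ {δ (overline w)} ∘ proj₁ (overline-δ-trivial σ rot) {w} ∘ kerσ {overline (δ w)}) ,
    (λ {w} → kerσ⁻ {overline (δ w)} ∘ proj₂ (overline-δ-trivial σ rot) {w} ∘ kerσ {δ (overline w)})

  -- The rotations of the mirror image and the `overline`-twisted rotations of `P` belong to the
  -- same flag Φ⁰, so `rotations-trivial` applies with the identity automorphism.
  ker-mirror : (r : ChiralOrDirectlyRegular P) (s : ChiralOrDirectlyRegular (mirror P)) →
    ker (Γ⁺ (mirror P) s) ≐ ker (Γ⁺ P r) ∘ overline
  ker-mirror r s
    with σ , rotσ , kerσ , kerσ⁻ ← rotations P r | τ , rotτ , kerτ , kerτ⁻ ← rotations (mirror P) s =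
    (λ {w} → kerσ⁻ {overline w} ∘ subst (G._≈ G.ε) (sym (eval-eval 𝔾 σ overline-gen w)) ∘
      rotations-trivial id Φ⁰ Φ⁰ τ (σ̄ σ) rotτ (rotσ̄ σ rotσ) Φ⁰∼Φ⁰ w ∘ kerτ {w}) ,
    (λ {w} → kerτ⁻ {w} ∘ rotations-trivial id Φ⁰ Φ⁰ (σ̄ σ) τ (rotσ̄ σ rotσ) rotτ Φ⁰∼Φ⁰ w ∘
      subst (G._≈ G.ε) (eval-eval 𝔾 σ overline-gen w) ∘ kerσ {overline w})
    where
    Φ⁰ = base ^ zero
    Φ⁰∼Φ⁰ : Orbit polytope Φ⁰ Φ⁰
    Φ⁰∼Φ⁰ = G.ε , λ _ → refl
    σ̄ : (Fin m → Automorphism polytope) → Fin m → Automorphism polytope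
    σ̄ σ = eval 𝔾 σ ∘ overline-gen
    rotσ̄ = rotations-overline id id-commutes base

  ker-dual : (r : ChiralOrDirectlyRegular P) (s : ChiralOrDirectlyRegular (P ᵟ)) →
    ker (Γ⁺ (P ᵟ) s) ≐ ker (Γ⁺ P r) ∘ δ
  ker-dual r s
    with σ , rotσ , kerσ , kerσ⁻ ← rotations P r | τ , rotτ , kerτ , kerτ⁻ ← rotations (P ᵟ) s =
    (λ {w} p → kerσ⁻ {δ w} λ F → trans (sym (eval-dual {σ} {τ} rotσ rotτ w F)) (kerτ {w} p F)) ,
    (λ {w} p → kerτ⁻ {w} λ F → trans (eval-dual {σ} {τ} rotσ rotτ w F) (kerσ {δ w} p F))
    where open DualRotations P

-- Subgroups stable under the involutions

-- Stability also gives the reverse inclusion, because v ≃ `δ (δ v)`.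
image-δ-stable : {N : Pred (Word m) ℓ} → Respects≃ N → (∀ w → N w → N (δ w)) → image δ N ≐ N
image-δ-stable resp stable =
  (λ (w , w∈N , v≃δw) → resp (symmetric v≃δw) (stable w w∈N)) ,
  (λ {v} v∈N → δ v , stable v v∈N , symmetric (δ-involutive v))

module _ {N : Pred (Word m) ℓ} (resp : Respects≃ N)
  (stable : ∀ w → N w → N (overline (δ w))) (stable′ : ∀ w → N w → N (δ (overline w))) where

  -- The composites `overline ∘ δ` and `δ ∘ overline` are inverse to each other on W⁺; stability
  -- under each gives one inclusion.
  fixed-by-overline-δ : N ≐ image overline (image δ N)
  fixed-by-overline-δ =
    (λ {v} v∈N → overline v ,
      (δ (overline v) , stable′ v v∈N , symmetric (δ-involutive (overline v))) ,
      symmetric (overline-involutive v)) ,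
    (λ (u , (w , w∈N , u≃δw) , v≃ū) →
      resp (symmetric (transitive v≃ū (overline-cong u≃δw))) (stable w w∈N))

  image-δ≐image-overline : image δ N ≐ image overline N
  image-δ≐image-overline =
    (λ (w , w∈N , v≃δw) → overline (δ w) , stable w w∈N ,
      transitive v≃δw (symmetric (overline-involutive (δ w)))) ,
    (λ (w , w∈N , v≃w̄) → δ (overline w) , stable′ w w∈N ,
      transitive v≃w̄ (symmetric (δ-involutive (overline w))))

-- Self-duality of the two mixes

mix-dual-selfDual : (P : PointedPolytope a ℓ (suc m)) (r : ChiralOrDirectlyRegular P)
  (rᵟ : ChiralOrDirectlyRegular (P ᵟ)) → ProperlySelfDual (Γ⁺ P r ⋄ Γ⁺ (P ᵟ) rᵟ)
-- Applying δ exchanges the conditions w ∈ M and `δ w` ∈ M.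
mix-dual-selfDual P r rᵟ = image-δ-stable {N = ker (R ⋄ Rᵈ)} (ker-respects (R ⋄ Rᵈ)) λ w p →
  let q , qᵈ = proj₁ (ker-⋄ R Rᵈ) {w} p
  in proj₂ (ker-⋄ R Rᵈ) {δ w}
    ( proj₁ (ker-dual P r rᵟ) {w} qᵈ
    , proj₂ (ker-dual P r rᵟ) {δ w} (ker-respects R {w} {δ (δ w)} (symmetric (δ-involutive w)) q))
  where
  R = Γ⁺ P r
  Rᵈ = Γ⁺ (P ᵟ) rᵟ

module _ (P : PointedPolytope a ℓ (suc m)) (r : ChiralOrDirectlyRegular P)
  (rᵟ : ChiralOrDirectlyRegular (P ᵟ)) (s : ChiralOrDirectlyRegular (mirror (P ᵟ))) where
  private
    R = Γ⁺ P r
    Rᵈ = Γ⁺ (P ᵟ) rᵟ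
    S = Γ⁺ (mirror (P ᵟ)) s

  -- The first condition is the given `δ (overline w)` ∈ M, transported by `ker-overline-δ`; the
  -- second reduces to w ∈ M by cancelling involutions.
  mix-mirror-dual-stable : ∀ w → ker (R ⋄ S) w → ker (R ⋄ S) (overline (δ w))
  mix-mirror-dual-stable w p =
    let q , qˢ = proj₁ (ker-⋄ R S) {w} p
    in proj₂ (ker-⋄ R S) {overline (δ w)}
      ( proj₂ (ker-overline-δ P r) {w}
          (proj₁ (ker-dual P r rᵟ) {overline w} (proj₁ (ker-mirror (P ᵟ) rᵟ s) {w} qˢ))
      , proj₂ (ker-mirror (P ᵟ) rᵟ s) {overline (δ w)}
          -- The two `overline` cancel underneath a δ; passing to the kernel of the dual, which
          -- respects ≃, takes that δ off.
          (ker-respects Rᵈ {δ w} {overline (overline (δ w))} (symmetric (overline-involutive (δ w)))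
            (proj₂ (ker-dual P r rᵟ) {δ w}
              (ker-respects R {w} {δ (δ w)} (symmetric (δ-involutive w)) q))))

  mix-mirror-dual-stable′ : ∀ w → ker (R ⋄ S) w → ker (R ⋄ S) (δ (overline w))
  mix-mirror-dual-stable′ w p =
    let q , qˢ = proj₁ (ker-⋄ R S) {w} p
    in proj₂ (ker-⋄ R S) {δ (overline w)}
      ( proj₁ (ker-dual P r rᵟ) {overline w} (proj₁ (ker-mirror (P ᵟ) rᵟ s) {w} qˢ)
      , proj₂ (ker-mirror (P ᵟ) rᵟ s) {δ (overline w)}
          (proj₂ (ker-dual P r rᵟ) {overline (δ (overline w))}
            -- Trades the outer `δ ∘ overline` for `overline ∘ δ`, so that the two δ meet and cancel
            -- and w ∈ M remains.
            (proj₁ (ker-overline-δ P r) {δ (overline w)}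
              (ker-respects R {w} {overline (δ (δ (overline w)))}
                (symmetric (transitive (overline-cong (δ-involutive (overline w))) (overline-involutive w))) q))))

  mix-mirror-dual-selfDual : let Q = Γ⁺ P r ⋄ Γ⁺ (mirror (P ᵟ)) s in
    (ker Q ≐ image overline (image δ (ker Q))) × (DirectlyRegularMix Q → ProperlySelfDual Q)
    × (ChiralMix Q → ImproperlySelfDual Q)
  mix-mirror-dual-selfDual =
    let respects = ker-respects (R ⋄ S)
        δ⊆overline , overline⊆δ = image-δ≐image-overline {N = ker (R ⋄ S)}
          respects mix-mirror-dual-stable mix-mirror-dual-stable′
    in fixed-by-overline-δ {N = ker (R ⋄ S)} respects mix-mirror-dual-stable mix-mirror-dual-stable′
     -- Direct regularity identifies the `overline`-image of the kernel with the kernel, so equality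
     -- of the two images becomes proper self-duality.
     , (λ (overline⊆ , ⊆overline) → (λ x → overline⊆ (δ⊆overline x)) , (λ x → overline⊆δ (⊆overline x)))
     , (λ chiral → chiral , δ⊆overline , overline⊆δ)

mainTheorem6 : {a ℓ : Level} {m : ℕ} →
    ((P : PointedPolytope a ℓ (suc m)) (r : ChiralOrDirectlyRegular P) →
    ProperlySelfDual (Γ⁺ P r ⋄ Γ⁺ (P ᵟ) (dual-chiralOrDirectlyRegular P r)))
    ×
    ((P : PointedPolytope a ℓ (suc m)) (ch : Chiral (PointedPolytope.polytope P)) →
    let Q = Γ⁺ P (inj₁ ch) ⋄ Γ⁺ (mirror (P ᵟ)) (inj₁ (DualRotations.dual-chiral P ch))
    in (ker Q ≐ image overline (image δ (ker Q)))
    × (DirectlyRegularMix Q → ProperlySelfDual Q)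
    × (ChiralMix Q → ImproperlySelfDual Q))
mainTheorem6 =
  (λ P r → mix-dual-selfDual P r (dual-chiralOrDirectlyRegular P r)) ,
  (λ P ch → let chᵟ = DualRotations.dual-chiral P ch in
    mix-mirror-dual-selfDual P (inj₁ ch) (inj₁ chᵟ) (inj₁ chᵟ))
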